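{- For all integers $r\geq 6$ there exists $n_0$ such that for all $0<\alpha\leq 2$, if $T$ is an $\alpha$-full $(n_1,n_2,\Delta_1,\Delta_2)$-tree with $n_1+n_2\geq n_0$ and $T$ is not a star, then $$\frac{\alpha r^2}{2304}\, n_1n_2 \;\leq\; \widehat{R}_r(T)\;\leq\; 4r^2 n_1n_2+4r(n_1+n_2)+1;$$ i.e. $\widehat{R}_r(T)=\Theta(r^2\beta(T))$.
   Context: Graphs are finite and simple. The $r$-color size-Ramsey number $\widehat{R}_r(H)$ of a graph $H$ is the minimum number of edges in a graph $G$ having the property that every $r$-coloring of the edges of $G$ contains a monochromatic copy of $H$ (as a not necessarily induced subgraph). A star is a graph of the form $K_{1,k}$. An $(n_1,n_2,\Delta_1,\Delta_2)$-bipartite graph is a connected bipartite graph with (unique) bipartition $\{V_1,V_2\}$ such that $|V_i|=n_i$ and $\Delta_i=\max\{d(v):v\in V_i\}$ for $i\in\{1,2\}$, where $d(v)$ is the degree of $v$; an $(n_1,n_2,\Delta_1,\Delta_2)$-tree is such a graph that is a tree. For such a graph $H$, $\beta(H)=n_1\Delta_1+n_2\Delta_2$. Given $0<\alpha\leq 2$, a connected bipartite graph $H$ with these parameters is called $\alpha$-full if $\beta(H)\geq \alpha n_1n_2$. The standard asymptotic notation $O(\cdot)$, $\Omega(\cdot)$, $\Theta(\cdot)$ is used; when a hidden constant may depend on a variable $\ell$, this is indicated by a subscript, for example $O_\ell(\cdot)$. -}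

module Defs where

open import Data.Bool using (Bool; true; false; T)
open import Data.Bool.Properties using (T?)
open import Data.Fin using (Fin; zero; suc; inject₁; fromℕ; _<?_)
open import Data.Fin.Subset using (Subset; _∈_; ∁; ∣_∣)
open import Data.Integer using (+_)
open import Data.List using (List; length; filter; cartesianProduct; allFin)
open import Data.Nat using (ℕ; zero; suc; _+_; _*_; _≤_)
open import Data.Product using (Σ-syntax; ∃-syntax; _×_; _,_)
open import Data.Rational using (ℚ; _/_) renaming (_<_ to _<ℚ_; _≤_ to _≤ℚ_; _*_ to _*ℚ_)
open import Data.Sum using (_⊎_)
open import Data.Vec using (tabulate)
open import Function.Bundles using (_↔_; _⇔_; Inverse)
open import Function.Definitions using (Injective)
open import Relation.Binary.Construct.Closure.ReflexiveTransitive using (Star)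
open import Relation.Binary.PropositionalEquality using (_≡_; refl)
open import Relation.Nullary using (¬_)
open import Relation.Nullary.Decidable using (_×-dec_)

-- Two-sided Dedekind cuts: L p means p < x, and U q means x < q.
record ℝ : Set₁ where
  field
    L U         : ℚ → Set
    L-inhabited : ∃[ p ] L p
    U-inhabited : ∃[ q ] U q
    L-rounded   : ∀ p → L p ⇔ (∃[ q ] (p <ℚ q × L q))
    U-rounded   : ∀ q → U q ⇔ (∃[ p ] (p <ℚ q × U p))
    disjoint    : ∀ p → ¬ (L p × U p)
    located     : ∀ p q → p <ℚ q → L p ⊎ U q

_<ʳ_ : ℚ → ℝ → Set
q <ʳ x = ℝ.L x q

_≤ʳ_ : ℝ → ℚ → Set
x ≤ʳ q = ∀ p → p <ʳ x → p ≤ℚ q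

-- x · q ≤ʳ t says that the real product xq is at most t.  Since x is the
-- supremum of the rationals below it, this is the correct condition for q ≥ 0,
-- and it should be used only for such q.
_·_≤ʳ_ : ℝ → ℚ → ℚ → Set
x · q ≤ʳ t = ∀ p → p <ʳ x → (p *ℚ q) ≤ℚ t

fromNat : ℕ → ℚ
fromNat m = + m / 1

record Graph (n : ℕ) : Set where
  field
    adj    : Fin n → Fin n → Bool
    sym    : ∀ u v → adj u v ≡ adj v u
    irrefl : ∀ v → adj v v ≡ false

  _~_ : Fin n → Fin n → Set
  u ~ v = T (adj u v)

  degree : Fin n → ℕ
  degree v = ∣ tabulate (adj v) ∣

  -- Each edge {u , v} is listed once, with u < v.
  edges : List (Fin n × Fin n)
  edges = filter (λ (u , v) → (u <? v) ×-dec T? (adj u v))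
                 (cartesianProduct (allFin n) (allFin n))

  size : ℕ
  size = length edges

  Connected : Set
  Connected = ∀ u v → Star _~_ u v

  -- A cycle is c₀ ~ c₁ ~ … ~ c₂₊ₖ ~ c₀ with distinct vertices.
  Cycle : Set
  Cycle = ∃[ k ] Σ[ c ∈ (Fin (3 + k) → Fin n) ]
            Injective _≡_ _≡_ c
          × (∀ i → c (inject₁ i) ~ c (suc i))
          × c (fromℕ (2 + k)) ~ c zero

  Acyclic : Set
  Acyclic = ¬ Cycle

  -- Δ = max { degree v : v ∈ V }; in particular V is nonempty.
  IsMaxDegree : Subset n → ℕ → Set
  IsMaxDegree V Δ = (∃[ v ] (v ∈ V × degree v ≡ Δ)) × (∀ v → v ∈ V → degree v ≤ Δ)

open Graph public using (size)

_≅_ : ∀ {m n} → Graph m → Graph n → Set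
_≅_ {m} {n} G H =
  Σ[ φ ∈ Fin m ↔ Fin n ]
    (∀ u v → Graph.adj G u v ≡ Graph.adj H (Inverse.to φ u) (Inverse.to φ v))

-- K₁,ₖ with centre zero.
K₁, : ∀ k → Graph (suc k)
K₁, k = record { adj = a ; sym = s ; irrefl = i }
  where
  a : Fin (suc k) → Fin (suc k) → Bool
  a zero    zero    = false
  a zero    (suc _) = true
  a (suc _) zero    = true
  a (suc _) (suc _) = false

  s : ∀ u v → a u v ≡ a v u
  s zero    zero    = refl
  s zero    (suc _) = refl
  s (suc _) zero    = refl
  s (suc _) (suc _) = refl

  i : ∀ v → a v v ≡ false
  i zero    = refl
  i (suc _) = refl

IsStar : ∀ {n} → Graph n → Set
IsStar G = ∃[ k ] (G ≅ K₁, k)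

-- (n₁ , n₂ , Δ₁ , Δ₂)-bipartite graphs; the second class V₂ is ∁ V₁.
record IsBipartite {n} (G : Graph n) (n₁ n₂ Δ₁ Δ₂ : ℕ) : Set where
  open Graph G
  field
    connected : Connected
    V₁        : Subset n
    V₁→V₂     : ∀ u v → u ~ v → u ∈ V₁ → v ∈ ∁ V₁
    V₂→V₁     : ∀ u v → u ~ v → u ∈ ∁ V₁ → v ∈ V₁
    ∣V₁∣      : ∣ V₁ ∣ ≡ n₁
    ∣V₂∣      : ∣ ∁ V₁ ∣ ≡ n₂
    maxDeg₁   : IsMaxDegree V₁ Δ₁
    maxDeg₂   : IsMaxDegree (∁ V₁) Δ₂

IsBipartiteTree : ∀ {n} → Graph n → (n₁ n₂ Δ₁ Δ₂ : ℕ) → Set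
IsBipartiteTree G n₁ n₂ Δ₁ Δ₂ = IsBipartite G n₁ n₂ Δ₁ Δ₂ × Graph.Acyclic G

β : (n₁ n₂ Δ₁ Δ₂ : ℕ) → ℕ
β n₁ n₂ Δ₁ Δ₂ = n₁ * Δ₁ + n₂ * Δ₂

Full : ℝ → (n₁ n₂ Δ₁ Δ₂ : ℕ) → Set
Full α n₁ n₂ Δ₁ Δ₂ = α · fromNat (n₁ * n₂) ≤ʳ fromNat (β n₁ n₂ Δ₁ Δ₂)

-- Colours are assigned to all pairs of vertices, but only the colours of edges
-- are ever inspected; for r ≥ 1 this is the same as colouring the edges alone.
record EdgeColouring (r : ℕ) {N} (G : Graph N) : Set where
  field
    colour : Fin N → Fin N → Fin r
    sym    : ∀ u v → colour u v ≡ colour v u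

record MonochromaticCopy {n N r} (H : Graph n) (G : Graph N) (c : EdgeColouring r G) : Set where
  open Graph H using () renaming (_~_ to _~ᴴ_)
  open Graph G using () renaming (_~_ to _~ᴳ_)
  open EdgeColouring c using (colour)
  field
    hue       : Fin r
    embed     : Fin n → Fin N
    injective : Injective _≡_ _≡_ embed
    edge      : ∀ u v → u ~ᴴ v → embed u ~ᴳ embed v
    mono      : ∀ u v → u ~ᴴ v → colour (embed u) (embed v) ≡ hue

Arrows : ∀ {n N} → ℕ → Graph N → Graph n → Set
Arrows r G H = ∀ (c : EdgeColouring r G) → MonochromaticCopy H G c

-- m is the r-colour size-Ramsey number of H: the minimum is attained, and is a
-- lower bound, over graphs with any number of vertices.
IsSizeRamsey : ∀ {n} → ℕ → Graph n → ℕ → Set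
IsSizeRamsey r H m =
    (∃[ N ] Σ[ G ∈ Graph N ] (Arrows r G H × size G ≡ m))
  × (∀ {N} (G : Graph N) → Arrows r G H → m ≤ size G)

{-# OPTIONS --safe #-}

-- Upper bound: K_{2rn₁,2rn₂} is Ramsey for T.  In its most frequent colour,
-- delete vertices of too small degree until every vertex on the n₁-side has n₂
-- neighbours and vice versa; T is then embedded greedily, vertex by vertex.
--
-- Lower bound: suppose 2304 |E(G)| < r²β.  One class of T, of size c and maximum
-- degree d + 1 say, satisfies 2c(d + 1) ≥ β, so the set A of vertices of G of
-- degree at least r(d + 1)/12 has fewer than rc/48 vertices.  Cut A into at
-- most 1 + r/16 blocks of at most c/2 consecutive vertices.  Edges inside A are
-- coloured by the sum of the two block numbers, so that a component of a colour
-- class meets at most two blocks, too few vertices for T.  Edges outside A are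
-- coloured greedily with at most d edges of each colour at each vertex.  Using
-- new colours, an edge from a ∈ A to v ∉ A gets the block of a plus ⌊i/d⌋, where
-- a is the i-th neighbour of v in A.  Hence in each colour v has at most d
-- neighbours, all in one block, so that neither placement of the classes of T is
-- possible.
--
-- The minimum is found by exhaustive search: deleting isolated vertices leaves
-- only finitely many graphs with at most a given number of edges.
module Submission where

open import Data.Bool using (Bool; true; false; if_then_else_; T; not; _xor_)
open import Data.Bool.Properties using (T?; T-≡; not-involutive; not-¬; xor-comm; xor-same; not-injective)
import Data.Bool.Properties as Bool
open import Data.Empty using (⊥)
open import Data.Fin using (Fin; zero; suc; toℕ; fromℕ<; inject₁; fromℕ; punchIn; punchOut)
open import Data.Fin.Properties using (_≟_; any?; all?; toℕ-injective; toℕ-fromℕ<; suc-injective)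
import Data.Fin as F
import Data.Fin.Properties as F
open import Data.Fin.Permutation using (transpose)
open import Data.Fin.Subset using (Subset; ∁; ∣_∣; _∈_)
open import Data.List using (List; length; filter; cartesianProduct; allFin; _++_)
import Data.List as List
open import Data.List.Properties using (filter-++; length-++; map-tabulate)
open import Data.List.Relation.Unary.All using (All; []; _∷_)
import Data.List.Relation.Unary.All as All
open import Data.List.Membership.Propositional.Properties using (∈-allFin; ∈-cartesianProduct⁺)
open import Data.Nat using (ℕ; zero; suc; _+_; _*_; _∸_; _≤_; _<_; z≤n; s≤s; _≤?_; _<?_; NonZero;  _<ᵇ_; _^_; >-nonZero; >-nonZero⁻¹)
  renaming (_/_ to _div_; _%_ to _mod_)
open import Data.Nat.DivMod using (m≡m%n+[m/n]*n; m%n<n; m/n*n≤m; m<n⇒m%n≡m; m<n*o⇒m/o<n; /-monoˡ-≤)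
open import Data.Nat.Tactic.RingSolver using (solve-∀)
open import Data.Nat.Properties hiding (_≟_; suc-injective)
import Data.Nat.Properties as ℕ
open import Data.Product using (∃; ∃-syntax; Σ-syntax; _×_; _,_; proj₁; proj₂)
open import Data.Sum using (_⊎_; inj₁; inj₂; [_,_]′)
open import Data.Unit using (⊤; tt)
open import Data.Vec using (tabulate; lookup)
import Data.Vec.Functional as Vector
import Data.Vec as Vec
open import Data.Vec.Properties using (lookup⇒[]=; []=⇒lookup; lookup-map)
open import Function using (_∘_; id)
open import Function.Bundles using (_↔_; Inverse; Equivalence)
open import Relation.Binary.Definitions using (Tri; tri<; tri≈; tri>)
open import Relation.Binary.Construct.Closure.ReflexiveTransitive using (Star; ε; _◅_; _◅◅_)
import Relation.Binary.Construct.Closure.ReflexiveTransitive as Star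
open import Relation.Binary.PropositionalEquality using (_≡_; _≢_; refl; sym; trans; cong; cong₂; subst; subst₂; module ≡-Reasoning)
open import Relation.Nullary using (¬_; Dec; yes; no; contradiction; does)
open import Relation.Nullary.Decidable using (_×-dec_; _⊎-dec_; _→-dec_; ¬?; map′; decidable-stable; toSum; dec-true; dec-false)
open import Relation.Unary using (Decidable)
open import Algebra.Properties.Semiring.Sum +-*-semiring
  using (sum; sum-cong-≗; ∑-distrib-+; ∑-comm; sum-remove; *-distribˡ-sum; *-distribʳ-sum)
open import Defs

private variable
  m n : ℕ
  P Q R : Fin n → Set

-- Counting in Fin n

sum-mono : {f g : Fin n → ℕ} → (∀ i → f i ≤ g i) → sum f ≤ sum g
sum-mono {zero}  _   = z≤n
sum-mono {suc n} f≤g = +-mono-≤ (f≤g zero) (sum-mono (f≤g ∘ suc))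

sum-const : ∀ n c → sum {n} (λ _ → c) ≡ n * c
sum-const zero    c = refl
sum-const (suc n) c = cong (c +_) (sum-const n c)

term≤sum : (f : Fin n → ℕ) (i : Fin n) → f i ≤ sum f
term≤sum f zero    = m≤m+n _ _
term≤sum f (suc i) = ≤-trans (term≤sum (f ∘ suc) i) (m≤n+m _ _)

sum-swap-mono : {f : Fin m → ℕ} {g : Fin n → ℕ} (h : Fin m → Fin n → ℕ) →
                (∀ i → f i ≤ sum (h i)) → (∀ j → sum (λ i → h i j) ≤ g j) → sum f ≤ sum g
sum-swap-mono h f≤h h≤g = ≤-trans (sum-mono f≤h) (≤-trans (≤-reflexive (∑-comm h)) (sum-mono h≤g))

ind : {A : Set} → Dec A → ℕ
ind A? = if does A? then 1 else 0

ind-yes : {A : Set} (A? : Dec A) → A → ind A? ≡ 1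
ind-yes (yes _)  _ = refl
ind-yes (no ¬a) a = contradiction a ¬a

ind-no : {A : Set} (A? : Dec A) → ¬ A → ind A? ≡ 0
ind-no (yes a) ¬a = contradiction a ¬a
ind-no (no _)  _  = refl

ind-mono : {A B : Set} (A? : Dec A) (B? : Dec B) → (A → B) → ind A? ≤ ind B?
ind-mono (yes a) B? f = ≤-reflexive (sym (ind-yes B? (f a)))
ind-mono (no _)  B? f = z≤n

ind-⊎ : {A B C : Set} (A? : Dec A) (B? : Dec B) (C? : Dec C) →
        (A → B ⊎ C) → ind A? ≤ ind B? + ind C?
ind-⊎ (no _)  B? C? f = z≤n
ind-⊎ (yes a) B? C? f with f a
... | inj₁ b rewrite ind-yes B? b = s≤s z≤n
... | inj₂ c rewrite ind-yes C? c = m≤n+m 1 _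

ind-disjoint : {A B C : Set} (A? : Dec A) (B? : Dec B) (C? : Dec C) →
               (A → C) → (B → C) → (A → ¬ B) → ind A? + ind B? ≤ ind C?
ind-disjoint (no _)  B?      C? f g h = ind-mono B? C? g
ind-disjoint (yes a) (yes b) C? f g h = contradiction b (h a)
ind-disjoint (yes a) (no _)  C? f g h = ≤-reflexive (sym (ind-yes C? (f a)))

count : {P : Fin n → Set} → Decidable P → ℕ
count P? = sum (λ x → ind (P? x))

count-mono : (P? : Decidable P) (Q? : Decidable Q) → (∀ x → P x → Q x) → count P? ≤ count Q?
count-mono P? Q? P⇒Q = sum-mono λ x → ind-mono (P? x) (Q? x) (P⇒Q x)

count-cong : (P? : Decidable P) (Q? : Decidable Q) →
             (∀ x → P x → Q x) → (∀ x → Q x → P x) → count P? ≡ count Q?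
count-cong P? Q? f g = ≤-antisym (count-mono P? Q? f) (count-mono Q? P? g)

count-⊎ : (P? : Decidable P) (Q? : Decidable Q) (R? : Decidable R) →
          (∀ x → P x → Q x ⊎ R x) → count P? ≤ count Q? + count R?
count-⊎ P? Q? R? f = ≤-trans (sum-mono λ x → ind-⊎ (P? x) (Q? x) (R? x) (f x))
                             (≤-reflexive (∑-distrib-+ (λ x → ind (Q? x)) (λ x → ind (R? x))))

count-none : (P? : Decidable P) → (∀ x → ¬ P x) → count P? ≡ 0
count-none {n} P? ¬P = trans (sum-cong-≗ λ x → ind-no (P? x) (¬P x)) (trans (sum-const n 0) (*-zeroʳ n))

count-all : (P? : Decidable {A = Fin n} P) → (∀ x → P x) → count P? ≡ n
count-all {n} P? p = trans (sum-cong-≗ λ x → ind-yes (P? x) (p x)) (trans (sum-const n 1) (*-identityʳ n))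

count-positive : (P? : Decidable P) {x : Fin n} → P x → 1 ≤ count P?
count-positive P? {x} px = subst (_≤ count P?) (ind-yes (P? x) px) (term≤sum _ x)

count-unique : (P? : Decidable {A = Fin n} P) → (∀ x y → P x → P y → x ≡ y) → count P? ≤ 1
count-unique {zero}  P? uniq = z≤n
count-unique {suc n} {P} P? uniq = go (P? zero)
  where
  rest : P zero → count (P? ∘ suc) ≡ 0
  rest p₀ = count-none (P? ∘ suc) λ x px → contradiction (uniq zero (suc x) p₀ px) λ ()
  go : (d : Dec (P zero)) → ind d + count (P? ∘ suc) ≤ 1
  go (yes p₀) rewrite rest p₀ = ≤-refl
  go (no _)   = count-unique (P? ∘ suc) λ x y px py → suc-injective (uniq (suc x) (suc y) px py)

count-strict : (P? : Decidable P) (Q? : Decidable Q) → (∀ x → P x → Q x) →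
               {z : Fin n} → Q z → ¬ P z → count P? < count Q?
count-strict P? Q? P⇒Q {z} qz ¬pz = begin
  suc (count P?)                       ≤⟨ +-monoˡ-≤ (count P?) (count-positive (_≟ z) refl) ⟩
  count (_≟ z) + count P?              ≡⟨ ∑-distrib-+ (λ x → ind (x ≟ z)) (λ x → ind (P? x)) ⟨
  sum (λ x → ind (x ≟ z) + ind (P? x)) ≤⟨ sum-mono (λ x → ind-disjoint (x ≟ z) (P? x) (Q? x)
                                            (λ { refl → qz }) (P⇒Q x) (λ { refl → ¬pz })) ⟩
  count Q?                             ∎
  where open ≤-Reasoning

count-injection : {P : Fin m → Set} {Q : Fin n → Set} {R : Fin m → Fin n → Set}
                  (P? : Decidable P) (Q? : Decidable Q) (R? : ∀ x → Decidable (R x)) →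
                  (∀ x → P x → ∃[ y ] (Q y × R x y)) →
                  (∀ {x x′ y} → R x y → R x′ y → x ≡ x′) →
                  count P? ≤ count Q?
count-injection {P = P} {Q} {R} P? Q? R? total inj = sum-swap-mono h below above
  where
  h : _ → _ → ℕ
  h x y = ind (Q? y ×-dec R? x y)
  below : ∀ x → ind (P? x) ≤ sum (h x)
  below x with P? x
  ... | no _   = z≤n
  ... | yes px = let y , qy , rxy = total x px in count-positive (λ y → Q? y ×-dec R? x y) {y} (qy , rxy)
  above : ∀ y → sum (λ x → h x y) ≤ ind (Q? y)
  above y with Q? y
  ... | no ¬qy = ≤-reflexive (count-none (λ x → no ¬qy ×-dec R? x y) λ x → ¬qy ∘ proj₁)
  ... | yes qy = count-unique (λ x → yes qy ×-dec R? x y) λ x x′ (_ , r) (_ , r′) → inj r r′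

count-unhit : {P : Fin m → Set} {Q : Fin n → Set} (P? : Decidable P) (Q? : Decidable Q)
              (f : Fin n → Fin m) → count Q? < count P? →
              ∃[ y ] (P y × (∀ x → Q x → f x ≢ y))
count-unhit {P = P} {Q} P? Q? f Q<P
  with any? (λ y → P? y ×-dec all? (λ x → Q? x →-dec ¬? (f x ≟ y)))
... | yes found = found
... | no none = contradiction
        (count-injection P? Q? (λ y x → f x ≟ y) hit λ fx≡y fx≡y′ → trans (sym fx≡y) fx≡y′)
        (<⇒≱ Q<P)
  where
  hit : ∀ y → P y → ∃[ x ] (Q x × f x ≡ y)
  hit y py with any? (λ x → Q? x ×-dec (f x ≟ y))
  ... | yes r = r
  ... | no ¬r = contradiction (y , py , λ x qx fx≡y → ¬r (x , qx , fx≡y)) none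

rank : {P : Fin n → Set} → Decidable P → Fin n → ℕ
rank P? x = count (λ y → P? y ×-dec (y F.<? x))

rank-mono : (P? : Decidable {A = Fin n} P) {x y : Fin n} → x F.≤ y → rank P? x ≤ rank P? y
rank-mono P? {x} {y} x≤y = count-mono (λ z → P? z ×-dec (z F.<? x)) (λ z → P? z ×-dec (z F.<? y))
                             λ z (pz , z<x) → pz , <-≤-trans z<x x≤y

rank-strict : (P? : Decidable {A = Fin n} P) {x y : Fin n} → P x → x F.< y → rank P? x < rank P? y
rank-strict P? {x} {y} px x<y =
  count-strict (λ z → P? z ×-dec (z F.<? x)) (λ z → P? z ×-dec (z F.<? y))
    (λ z (pz , z<x) → pz , <-trans z<x x<y) (px , x<y) λ (_ , x<x) → <-irrefl refl x<x

rank<count : (P? : Decidable {A = Fin n} P) {x : Fin n} → P x → rank P? x < count P?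
rank<count P? {x} px =
  count-strict (λ z → P? z ×-dec (z F.<? x)) P? (λ _ → proj₁) px λ (_ , x<x) → <-irrefl refl x<x

rank-injective : (P? : Decidable {A = Fin n} P) {x y : Fin n} → P x → P y →
                 rank P? x ≡ rank P? y → x ≡ y
rank-injective P? {x} {y} px py eq with F.<-cmp x y
... | tri< x<y _ _ = contradiction eq (<⇒≢ (rank-strict P? px x<y))
... | tri≈ _ x≡y _ = x≡y
... | tri> _ _ y<x = contradiction (sym eq) (<⇒≢ (rank-strict P? py y<x))

count-rank-window : (P? : Decidable {A = Fin n} P) (d : ℕ) .{{_ : NonZero d}} (i : ℕ) →
                    count (λ x → P? x ×-dec (rank P? x div d ℕ.≟ i)) ≤ d
count-rank-window {P = P} P? d i = ≤-trans
  (count-injection W? (λ (_ : Fin d) → yes tt)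
    (λ x y → W? x ×-dec (rank P? x mod d ℕ.≟ toℕ y))
    (λ x w → fromℕ< (m%n<n (rank P? x) d) , tt , w , sym (toℕ-fromℕ< _))
    (λ ((px , q) , e) ((px′ , q′) , e′) → rank-injective P? px px′ (begin
       _                                   ≡⟨ m≡m%n+[m/n]*n _ d ⟩
       _ mod d + _ div d * d                   ≡⟨ cong₂ (λ a b → a + b * d) (trans e (sym e′)) (trans q (sym q′)) ⟩
       _ mod d + _ div d * d                   ≡⟨ m≡m%n+[m/n]*n _ d ⟨
       _                                   ∎)))
  (≤-reflexive (count-all {n = d} (λ _ → yes tt) λ _ → tt))
  where
  open ≡-Reasoning
  W? : Decidable (λ x → P x × rank P? x div d ≡ i)
  W? x = P? x ×-dec (rank P? x div d ℕ.≟ i)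

-- Degrees and sizes as sums

∣∣≡count : (V : Subset n) → ∣ V ∣ ≡ count (λ v → lookup V v Bool.≟ true)
∣∣≡count Vec.[] = refl
∣∣≡count (true Vec.∷ V)  = cong suc (∣∣≡count V)
∣∣≡count (false Vec.∷ V) = ∣∣≡count V

∣tabulate∣≡count : (p : Fin n → Bool) → ∣ tabulate p ∣ ≡ count (T? ∘ p)
∣tabulate∣≡count {zero}  p = refl
∣tabulate∣≡count {suc n} p with p zero
... | true  = cong suc (∣tabulate∣≡count (p ∘ suc))
... | false = ∣tabulate∣≡count (p ∘ suc)

length-filter-tabulate : {A : Set} {P : A → Set} (P? : Decidable P) (h : Fin n → A) →
                         length (filter P? (List.tabulate h)) ≡ count (P? ∘ h)
length-filter-tabulate {zero}  P? h = refl
length-filter-tabulate {suc n} P? h with P? (h zero)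
... | yes _ = cong suc (length-filter-tabulate P? (h ∘ suc))
... | no _  = length-filter-tabulate P? (h ∘ suc)

length-filter-cartesianProduct :
  {A B : Set} {P : A × B → Set} (P? : Decidable P) (g : Fin m → A) (h : Fin n → B) →
  length (filter P? (cartesianProduct (List.tabulate g) (List.tabulate h)))
    ≡ sum (λ i → count (λ j → P? (g i , h j)))
length-filter-cartesianProduct {zero}  P? g h = refl
length-filter-cartesianProduct {suc m} P? g h = begin
  length (filter P? (List.map (g zero ,_) (List.tabulate h) ++ rest))
    ≡⟨ cong length (filter-++ P? (List.map (g zero ,_) (List.tabulate h)) rest) ⟩
  length (filter P? (List.map (g zero ,_) (List.tabulate h)) ++ filter P? rest)
    ≡⟨ length-++ (filter P? (List.map (g zero ,_) (List.tabulate h))) ⟩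
  length (filter P? (List.map (g zero ,_) (List.tabulate h))) + length (filter P? rest)
    ≡⟨ cong₂ _+_ (trans (cong (length ∘ filter P?) (map-tabulate h (g zero ,_)))
                        (length-filter-tabulate P? (λ j → g zero , h j)))
                 (length-filter-cartesianProduct P? (g ∘ suc) h) ⟩
  _ ∎
  where
  open ≡-Reasoning
  rest = cartesianProduct (List.tabulate (g ∘ suc)) (List.tabulate h)

module GraphProperties (G : Graph n) where
  open Graph G public using (adj; degree; _~_; Connected; Acyclic)

  ~-sym : ∀ {u v} → u ~ v → v ~ u
  ~-sym {u} {v} = subst T (Graph.sym G u v)

  ~-irrefl : ∀ {v} → ¬ v ~ v
  ~-irrefl {v} = subst T (Graph.irrefl G v)

  degree≡count : ∀ v → degree v ≡ count (λ w → T? (adj v w))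
  degree≡count v = ∣tabulate∣≡count (adj v)

  2*size≡∑adj : 2 * size G ≡ sum (λ u → count (λ v → T? (adj u v)))
  2*size≡∑adj = begin
    2 * size G                                          ≡⟨ cong (size G +_) (+-identityʳ _) ⟩
    size G + size G                                     ≡⟨ cong₂ _+_ size≡ (trans size≡ (∑-comm (λ u v → ind (e u v)))) ⟩
    sum (λ u → count (e u)) + sum (λ v → sum λ u → ind (e u v))
      ≡⟨ ∑-distrib-+ (λ u → count (e u)) (λ v → sum λ u → ind (e u v)) ⟨
    sum (λ u → count (e u) + sum (λ v → ind (e v u)))   ≡⟨ sum-cong-≗ (λ u → sym (∑-distrib-+ (λ v → ind (e u v)) (λ v → ind (e v u)))) ⟩
    sum (λ u → sum (λ v → ind (e u v) + ind (e v u)))   ≡⟨ sum-cong-≗ (λ u → sum-cong-≗ (pair u)) ⟩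
    sum (λ u → count (λ v → T? (adj u v)))              ∎
    where
    open ≡-Reasoning
    e : ∀ u v → Dec ((u F.< v) × T (adj u v))
    e u v = (u F.<? v) ×-dec T? (adj u v)
    size≡ : size G ≡ sum (λ u → count (e u))
    size≡ = length-filter-cartesianProduct (λ (u , v) → e u v) id id
    pair : ∀ u v → ind (e u v) + ind (e v u) ≡ ind (T? (adj u v))
    pair u v with T? (adj u v)
    ... | no ¬a = trans (cong₂ _+_ (ind-no (e u v) (¬a ∘ proj₂)) (ind-no (e v u) λ (_ , a) → ¬a (~-sym a)))
                        (sym (ind-no (T? (adj u v)) ¬a))
    ... | yes a = trans (once (F.<-cmp u v)) (sym (ind-yes (T? (adj u v)) a))
      where
      once : Tri (u F.< v) (u ≡ v) (v F.< u) → ind (e u v) + ind (e v u) ≡ 1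
      once (tri< u<v _ v≮u) = cong₂ _+_ (ind-yes (e u v) (u<v , a)) (ind-no (e v u) (v≮u ∘ proj₁))
      once (tri≈ _ u≡v _)   = contradiction (subst (_~ v) u≡v a) ~-irrefl
      once (tri> u≮v _ v<u) = cong₂ _+_ (ind-no (e u v) (u≮v ∘ proj₁)) (ind-yes (e v u) (v<u , ~-sym a))

  ∑degree≡2*size : sum degree ≡ 2 * size G
  ∑degree≡2*size = trans (sum-cong-≗ degree≡count) (sym 2*size≡∑adj)

-- Bipartite graphs are handled through a side function, which makes the two
-- classes interchangeable.
record Sided (H : Graph n) : Set where
  open GraphProperties H
  field
    side      : Fin n → Bool
    opposite  : ∀ {u v} → u ~ v → side v ≡ not (side u)
    connected : Connected
    inhabited : ∀ b → ∃[ v ] side v ≡ b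

  side? : ∀ b → Decidable (λ v → side v ≡ b)
  side? b v = side v Bool.≟ b

  classSize : Bool → ℕ
  classSize b = count (side? b)

  neighbour : ∀ u → ∃[ v ] u ~ v
  neighbour u with inhabited (not (side u))
  ... | v , sv with connected u v
  ... | ε       = contradiction sv (not-¬ refl)
  ... | u~w ◅ _ = _ , u~w

  degree≤classSize : ∀ u → degree u ≤ classSize (not (side u))
  degree≤classSize u = ≤-trans (≤-reflexive (degree≡count u))
    (count-mono (λ w → T? (adj u w)) (side? (not (side u))) λ w → opposite)

-- Stars

module _ {k} (H : Graph (suc k)) where
  open GraphProperties H

  star-iso : (c : Fin (suc k)) → (∀ v → v ≢ c → c ~ v) → (∀ u v → u ≢ c → v ≢ c → ¬ u ~ v) →
             (π : Fin (suc k) ↔ Fin (suc k)) → Inverse.to π c ≡ zero →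
             ∀ u v → adj u v ≡ Graph.adj (K₁, k) (Inverse.to π u) (Inverse.to π v)
  star-iso c spoke rim π c↦0 = same
    where
    to = Inverse.to π
    ↦0 : ∀ {u} → to u ≡ zero → u ≡ c
    ↦0 {u} eq = trans (sym (Inverse.strictlyInverseʳ π u))
      (trans (cong (Inverse.from π) (trans eq (sym c↦0))) (Inverse.strictlyInverseʳ π c))
    ~⇒true : ∀ {u v} → u ~ v → adj u v ≡ true
    ~⇒true = Equivalence.to T-≡
    ≁⇒false : ∀ {u v} → ¬ u ~ v → adj u v ≡ false
    ≁⇒false {u} {v} ¬a with adj u v
    ... | true = contradiction tt ¬a
    ... | false = refl
    same : ∀ u v → adj u v ≡ Graph.adj (K₁, k) (to u) (to v)
    same u v with u ≟ c | v ≟ c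
    ... | yes refl | yes refl rewrite c↦0 = ≁⇒false ~-irrefl
    ... | yes refl | no v≢c rewrite c↦0 with to v in eq
    ... | zero  = contradiction (↦0 eq) v≢c
    ... | suc _ = ~⇒true (spoke v v≢c)
    same u v | no u≢c | yes refl rewrite c↦0 with to u in eq
    ... | zero  = contradiction (↦0 eq) u≢c
    ... | suc _ = ~⇒true (~-sym (spoke u u≢c))
    same u v | no u≢c | no v≢c with to u in eq | to v in eq′
    ... | zero  | _     = contradiction (↦0 eq) u≢c
    ... | suc _ | zero  = contradiction (↦0 eq′) v≢c
    ... | suc _ | suc _ = ≁⇒false (rim u v u≢c v≢c)

  isStar-from-centre : (c : Fin (suc k)) → (∀ v → v ≢ c → c ~ v) →
                       (∀ u v → u ≢ c → v ≢ c → ¬ u ~ v) → IsStar H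
  isStar-from-centre c spoke rim =
    k , transpose c zero , star-iso c spoke rim (transpose c zero) centred
    where
    centred : Inverse.to (transpose c zero) c ≡ zero
    centred with c ≟ c
    ... | yes _  = refl
    ... | no c≢c = contradiction refl c≢c

isStar-of-degree≤1 : (H : Graph n) (S : Sided H) (b : Bool) →
                     (∀ v → Sided.side S v ≡ b → Graph.degree H v ≤ 1) → IsStar H
isStar-of-degree≤1 {zero}  H S b deg≤1 with () ← proj₁ (Sided.inhabited S true)
isStar-of-degree≤1 {suc k} H S b deg≤1 = isStar-from-centre H c
    (λ v v≢c → [ (λ v≡c → contradiction v≡c v≢c) , id ]′ (reach (connected c v) (inj₁ refl)))
    λ u v u≢c v≢c u~v → contradiction (trans (sym (leaf v≢c)) (trans (opposite u~v) (cong not (leaf u≢c)))) (not-¬ refl)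
  where
  open GraphProperties H hiding (Connected)
  open Sided S
  t₀ = proj₁ (inhabited b)
  c = proj₁ (neighbour t₀)
  t₀~c : t₀ ~ c
  t₀~c = proj₂ (neighbour t₀)
  side-c : side c ≡ not b
  side-c = trans (opposite t₀~c) (cong not (proj₂ (inhabited b)))
  single : ∀ {u v w} → side u ≡ b → u ~ v → u ~ w → v ≡ w
  single {u} {v} {w} su u~v u~w with v ≟ w
  ... | yes v≡w = v≡w
  ... | no v≢w = contradiction
    (≤-trans (s≤s (count-positive (_≟ v) refl)) (count-strict (_≟ v) (λ w → T? (adj u w)) (λ { _ refl → u~v }) u~w (v≢w ∘ sym)))
    (≤⇒≯ (subst (_≤ 1) (degree≡count u) (deg≤1 u su)))
  spoke-side : ∀ {v} → c ~ v → side v ≡ b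
  spoke-side c~v = trans (opposite c~v) (trans (cong not side-c) (not-involutive b))
  reach : ∀ {u v} → Star _~_ u v → u ≡ c ⊎ c ~ u → v ≡ c ⊎ c ~ v
  reach ε          at = at
  reach (u~w ◅ ws) (inj₁ refl) = reach ws (inj₂ u~w)
  reach (u~w ◅ ws) (inj₂ c~u)  = reach ws (inj₁ (single (spoke-side c~u) u~w (~-sym c~u)))
  leaf : ∀ {v} → v ≢ c → side v ≡ b
  leaf {v} v≢c with reach (connected c v) (inj₁ refl)
  ... | inj₁ v≡c = contradiction v≡c v≢c
  ... | inj₂ c~v = spoke-side c~v

sum-at : (x : Fin n) (f : Fin n → ℕ) → sum (λ u → ind (u ≟ x) * f u) ≡ f x
sum-at x f = begin
  sum (λ u → ind (u ≟ x) * f u) ≡⟨ sum-cong-≗ at ⟩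
  sum (λ u → ind (u ≟ x) * f x) ≡⟨ *-distribʳ-sum (f x) (λ u → ind (u ≟ x)) ⟨
  count (_≟ x) * f x            ≡⟨ cong (_* f x) (≤-antisym
                                      (count-unique (_≟ x) λ { _ _ refl refl → refl })
                                      (count-positive (_≟ x) refl)) ⟩
  1 * f x                       ≡⟨ *-identityˡ (f x) ⟩
  f x                           ∎
  where
  open ≡-Reasoning
  at : ∀ u → ind (u ≟ x) * f u ≡ ind (u ≟ x) * f x
  at u with u ≟ x
  ... | yes refl = refl
  ... | no _     = refl

count-at : (x : Fin n) {A : Set} (A? : Dec A) → count (λ v → (v ≟ x) ×-dec A?) ≤ ind A?
count-at x (yes a) = count-unique (λ v → (v ≟ x) ×-dec yes a) λ { _ _ (refl , _) (refl , _) → refl }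
count-at x (no ¬a) = ≤-reflexive (count-none (λ v → (v ≟ x) ×-dec no ¬a) λ _ → ¬a ∘ proj₂)

-- Subgraphs of large minimum degree

module DenseSubgraph {N} {M : Fin N → Fin N → Set} (M? : ∀ u → Decidable (M u))
                     (M-sym : ∀ {u v} → M u v → M v u) (w : Fin N → ℕ) where

  pair? : {S : Fin N → Set} → Decidable S → ∀ u → Decidable (λ v → S u × S v × M u v)
  pair? S? u v = S? u ×-dec (S? v ×-dec M? u v)

  pairs : {S : Fin N → Set} → Decidable S → ℕ
  pairs S? = sum (λ u → count (pair? S? u))

  degreeIn : {S : Fin N → Set} → Decidable S → Fin N → ℕ
  degreeIn S? u = count (λ v → S? v ×-dec M? u v)

  weight : {S : Fin N → Set} → Decidable S → ℕ
  weight S? = sum (λ u → ind (S? u) * w u)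

  _except_ : {S : Fin N → Set} → Decidable S → (x : Fin N) → Decidable (λ v → S v × v ≢ x)
  (S? except x) v = S? v ×-dec ¬? (v ≟ x)

  weight-except : {S : Fin N → Set} (S? : Decidable S) {x : Fin N} → S x →
                  weight (S? except x) + w x ≤ weight S?
  weight-except S? {x} sx = begin
    weight (S? except x) + w x   ≡⟨ cong (weight (S? except x) +_) (sum-at x w) ⟨
    weight (S? except x) + sum (λ u → ind (u ≟ x) * w u)
      ≡⟨ ∑-distrib-+ (λ u → ind ((S? except x) u) * w u) (λ u → ind (u ≟ x) * w u) ⟨
    sum (λ u → ind ((S? except x) u) * w u + ind (u ≟ x) * w u)
      ≤⟨ sum-mono (λ u → ≤-trans
           (≤-reflexive (sym (*-distribʳ-+ (w u) (ind ((S? except x) u)) (ind (u ≟ x)))))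
           (*-monoˡ-≤ (w u) (ind-disjoint ((S? except x) u) (u ≟ x) (S? u) proj₁ (λ { refl → sx }) proj₂))) ⟩
    weight S?                    ∎
    where open ≤-Reasoning

  pairs-except : {S : Fin N → Set} (S? : Decidable S) (x : Fin N) →
                 pairs S? ≤ pairs (S? except x) + 2 * degreeIn S? x
  pairs-except {S} S? x = begin
    pairs S? ≤⟨ sum-mono bound ⟩
    sum (λ u → count (pair? S?′ u) + (ind (u ≟ x) * degreeIn S? u + ind (S? u ×-dec M? x u)))
      ≡⟨ ∑-distrib-+ (λ u → count (pair? S?′ u)) _ ⟩
    pairs S?′ + sum (λ u → ind (u ≟ x) * degreeIn S? u + ind (S? u ×-dec M? x u))
      ≡⟨ cong (pairs S?′ +_) (∑-distrib-+ (λ u → ind (u ≟ x) * degreeIn S? u) _) ⟩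
    pairs S?′ + (sum (λ u → ind (u ≟ x) * degreeIn S? u) + degreeIn S? x)
      ≡⟨ cong (λ z → pairs S?′ + (z + degreeIn S? x)) (sum-at x (degreeIn S?)) ⟩
    pairs S?′ + (degreeIn S? x + degreeIn S? x)
      ≡⟨ cong (λ z → pairs S?′ + (degreeIn S? x + z)) (+-identityʳ _) ⟨
    pairs S?′ + 2 * degreeIn S? x ∎
    where
    open ≤-Reasoning
    S?′ = S? except x
    bound : ∀ u → count (pair? S? u) ≤
                  count (pair? S?′ u) + (ind (u ≟ x) * degreeIn S? u + ind (S? u ×-dec M? x u))
    bound u with u ≟ x
    ... | yes refl = begin
      count (pair? S? x)     ≤⟨ count-mono (pair? S? x) (λ v → S? v ×-dec M? x v) (λ _ → proj₂) ⟩
      degreeIn S? x          ≡⟨ *-identityˡ _ ⟨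
      1 * degreeIn S? x      ≤⟨ m≤m+n _ _ ⟩
      1 * degreeIn S? x + ind (S? x ×-dec M? x x) ≤⟨ m≤n+m _ (count (λ v → (S? x ×-dec ¬? (yes (refl {x = x}))) ×-dec (S?′ v ×-dec M? x v))) ⟩
      _                      ∎
    ... | no u≢x = ≤-trans
      (count-⊎ (pair? S? u) (λ v → (S? u ×-dec ¬? (no u≢x)) ×-dec (S?′ v ×-dec M? u v))
               (λ v → (v ≟ x) ×-dec (S? u ×-dec M? x u)) split)
      (+-monoʳ-≤ _ (count-at x (S? u ×-dec M? x u)))
      where
      split : ∀ v → S u × S v × M u v → ((S u × u ≢ x) × (S v × v ≢ x) × M u v) ⊎ (v ≡ x × S u × M x u)
      split v (su , sv , uv) with v ≟ x
      ... | yes refl = inj₂ (refl , su , M-sym uv)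
      ... | no v≢x   = inj₁ ((su , u≢x) , (sv , v≢x) , uv)

  -- Deleting a vertex of degree at most its weight preserves 2 · weight < pairs.
  dense-subgraph : {S : Fin N → Set} (S? : Decidable S) → 2 * weight S? < pairs S? →
                   Σ[ S′ ∈ (Fin N → Set) ] Σ[ S′? ∈ Decidable S′ ]
                     ((∀ u → S′ u → w u < degreeIn S′? u) × ∃ S′)
  dense-subgraph S? = go (count S?) S? ≤-refl
    where
    go : ∀ k {S : Fin N → Set} (S? : Decidable S) → count S? ≤ k → 2 * weight S? < pairs S? → _
    go k {S} S? S≤k dense with any? (λ u → S? u ×-dec (degreeIn S? u ≤? w u))
    ... | no good = S , S? , (λ u su → ≰⇒> λ small → good (u , su , small)) , nonempty
      where
      nonempty : ∃ S
      nonempty with any? S?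
      ... | yes ne = ne
      ... | no empty = contradiction
        (trans (sum-cong-≗ λ u → count-none (pair? S? u) λ _ (su , _) → empty (u , su))
               (trans (sum-const N 0) (*-zeroʳ N)))
        (>⇒≢ (≤-trans (s≤s z≤n) dense))
    go zero S? S≤0 dense | yes (x , sx , _) = contradiction (≤-trans (count-positive S? sx) S≤0) λ ()
    go (suc k) S? S≤k dense | yes (x , sx , small) = go k (S? except x)
      (≤-pred (≤-trans (count-strict (S? except x) S? (λ _ → proj₁) sx λ (_ , x≢x) → x≢x refl) S≤k))
      (+-cancelʳ-< (2 * w x) _ _ (begin-strict
        2 * weight (S? except x) + 2 * w x  ≡⟨ *-distribˡ-+ 2 (weight (S? except x)) (w x) ⟨
        2 * (weight (S? except x) + w x)    ≤⟨ *-monoʳ-≤ 2 (weight-except S? sx) ⟩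
        2 * weight S?                       <⟨ dense ⟩
        pairs S?                            ≤⟨ pairs-except S? x ⟩
        pairs (S? except x) + 2 * degreeIn S? x ≤⟨ +-monoʳ-≤ (pairs (S? except x)) (*-monoʳ-≤ 2 small) ⟩
        pairs (S? except x) + 2 * w x       ∎))
      where open ≤-Reasoning

-- Greedy embedding of trees

update : {A : Set} → (Fin n → A) → Fin n → A → Fin n → A
update f w y v = if does (v ≟ w) then y else f v

update-same : {A : Set} (f : Fin n → A) (w : Fin n) (y : A) → update f w y w ≡ y
update-same f w y with w ≟ w
... | yes _  = refl
... | no w≢w = contradiction refl w≢w

update-other : {A : Set} (f : Fin n → A) {v w : Fin n} (y : A) → v ≢ w → update f w y v ≡ f v
update-other f {v} {w} y v≢w with v ≟ w
... | yes v≡w = contradiction v≡w v≢w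
... | no _    = refl

module _ {n} (H : Graph n) where
  open GraphProperties H

  record SimplePath (D : Fin n → Set) (u v : Fin n) : Set where
    field
      len       : ℕ
      at        : Fin (suc len) → Fin n
      injective : ∀ {i j} → at i ≡ at j → i ≡ j
      step      : ∀ i → at (inject₁ i) ~ at (suc i)
      start     : at zero ≡ u
      end       : at (fromℕ len) ≡ v
      inside    : ∀ i → D (at i)

  module _ {D : Fin n → Set} where

    trivialPath : ∀ {u} → D u → SimplePath D u u
    trivialPath {u} du = record
      { len = 0 ; at = λ _ → u ; injective = λ { {zero} {zero} _ → refl } ; step = λ ()
      ; start = refl ; end = refl ; inside = λ _ → du }

    suffix : ∀ {u v} (p : SimplePath D u v) j → SimplePath D (SimplePath.at p j) v
    suffix p zero = record { SimplePath p ; start = refl }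
    suffix record { len = suc l ; at = at ; injective = inj ; step = step ; end = end ; inside = inside } (suc j) =
      suffix record { len = l ; at = at ∘ suc ; injective = suc-injective ∘ inj ; step = step ∘ suc
                    ; start = refl ; end = end ; inside = inside ∘ suc } j

    extend : ∀ {w u v} → D w → w ~ u → (p : SimplePath D u v) →
             (∀ i → SimplePath.at p i ≢ w) → SimplePath D w v
    extend {w} dw w~u p fresh = record
      { len = suc len ; at = at⁺ ; injective = inj⁺ ; step = step⁺ ; start = refl ; end = end ; inside = inside⁺ }
      where
      open SimplePath p
      at⁺ : Fin (suc (suc len)) → Fin n
      at⁺ zero    = w
      at⁺ (suc i) = at i
      inj⁺ : ∀ {i j} → at⁺ i ≡ at⁺ j → i ≡ j
      inj⁺ {zero}  {zero}  _  = refl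
      inj⁺ {zero}  {suc j} eq = contradiction (sym eq) (fresh j)
      inj⁺ {suc i} {zero}  eq = contradiction eq (fresh i)
      inj⁺ {suc i} {suc j} eq = cong suc (injective eq)
      step⁺ : ∀ i → at⁺ (inject₁ i) ~ at⁺ (suc i)
      step⁺ zero    = subst (w ~_) (sym start) w~u
      step⁺ (suc i) = step i
      inside⁺ : ∀ i → D (at⁺ i)
      inside⁺ zero    = dw
      inside⁺ (suc i) = inside i

  Within : (Fin n → Set) → Fin n → Fin n → Set
  Within D u v = u ~ v × D u × D v

  loopErasure : ∀ {D u v} → D v → Star (Within D) u v → SimplePath D u v
  loopErasure dv ε = trivialPath dv
  loopErasure {D} {v = v} dv (_◅_ {u} (u~w , du , _) ws) = prepend (any? λ i → SimplePath.at p i ≟ u)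
    where
    p = loopErasure dv ws
    prepend : Dec (∃[ i ] SimplePath.at p i ≡ u) → SimplePath D u v
    prepend (yes (i , eq)) = subst (λ z → SimplePath D z v) eq (suffix p i)
    prepend (no avoids)    = extend du u~w p λ i eq → avoids (i , eq)

  unique-attachment : Acyclic → ∀ {D w u v} → ¬ D w → D u → D v → Star (Within D) u v →
                      w ~ u → w ~ v → u ≡ v
  unique-attachment acyclic {D} {w} {u} {v} ¬dw du dv walk w~u w~v = close (loopErasure dv walk)
    where
    close : SimplePath D u v → u ≡ v
    close record { len = zero ; start = refl ; end = refl } = refl
    close p@record { len = suc k } = contradiction cycle acyclic
      where
      open SimplePath p
      c : SimplePath (λ _ → ⊤) w v
      c = extend tt w~u record { SimplePath p ; inside = λ _ → tt } λ i eq → ¬dw (subst D eq (inside i))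
      cycle : Graph.Cycle H
      cycle = k , SimplePath.at c , SimplePath.injective c , SimplePath.step c ,
              subst (_~ w) (sym end) (~-sym w~v)

  crossing : {D : Fin n → Set} → Decidable D → ∀ {u v} → Star _~_ u v → D u → ¬ D v →
             ∃[ a ] ∃[ b ] (a ~ b × D a × ¬ D b)
  crossing D? ε du ¬dv = contradiction du ¬dv
  crossing D? (_◅_ {j = w} u~w ws) du ¬dv with D? w
  ... | yes dw = crossing D? ws dw ¬dv
  ... | no ¬dw = _ , w , u~w , du , ¬dw

module TreeEmbedding {n N} (H : Graph n) (sided : Sided H) (acyclic : Graph.Acyclic H)
  {M : Fin N → Fin N → Set} (M? : ∀ u → Decidable (M u)) (M-sym : ∀ {u v} → M u v → M v u)
  {S : Fin N → Set} (S? : Decidable S) (σ : Fin N → Bool) (M-opposite : ∀ {u v} → M u v → σ v ≡ not (σ u))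
  (rich : ∀ u → S u → Sided.classSize sided (not (σ u)) ≤ count (λ v → S? v ×-dec M? u v))
  where
  open GraphProperties H hiding (Connected)
  open Sided sided

  record Partial (D : Fin n → Set) : Set where
    field
      f        : Fin n → Fin N
      linked   : ∀ {u v} → D u → D v → Star (Within H D) u v
      inj      : ∀ {u v} → D u → D v → f u ≡ f v → u ≡ v
      hom      : ∀ {u v} → D u → D v → u ~ v → M (f u) (f v)
      f-in     : ∀ {u} → D u → S (f u)
      f-side   : ∀ {u} → D u → σ (f u) ≡ side u

  module _ {D : Fin n → Set} (D? : Decidable D) (p : Partial D) {u w : Fin n}
           (u~w : u ~ w) (du : D u) (¬dw : ¬ D w) where
    open Partial p

    private
      D⁺ : Fin n → Set
      D⁺ v = D v ⊎ v ≡ w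

      fresh : ∃[ y ] ((S y × M (f u) y) × (∀ v → D v × side v ≡ side w → f v ≢ y))
      fresh = count-unhit (λ y → S? y ×-dec M? (f u) y) (λ v → D? v ×-dec side? (side w) v) f
        (<-≤-trans
          (count-strict (λ v → D? v ×-dec side? (side w) v) (side? (side w)) (λ _ → proj₂) refl (¬dw ∘ proj₁))
          (subst (λ b → classSize b ≤ _) (trans (cong not (f-side du)) (sym (opposite u~w))) (rich (f u) (f-in du))))

      y = proj₁ fresh
      y-in : S y
      y-in = proj₁ (proj₁ (proj₂ fresh))
      fu-y : M (f u) y
      fu-y = proj₂ (proj₁ (proj₂ fresh))
      y-side : σ y ≡ side w
      y-side = trans (M-opposite fu-y) (trans (cong not (f-side du)) (sym (opposite u~w)))
      y-new : ∀ {v} → D v → f v ≢ y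
      y-new {v} dv fv≡y = proj₂ (proj₂ fresh) v
        (dv , trans (sym (f-side dv)) (trans (cong σ fv≡y) y-side)) fv≡y

      f⁺ : Fin n → Fin N
      f⁺ = update f w y

      f⁺-w : f⁺ w ≡ y
      f⁺-w = update-same f w y

      f⁺-D : ∀ {v} → D v → f⁺ v ≡ f v
      f⁺-D dv = update-other f y λ v≡w → ¬dw (subst D v≡w dv)

      widen : ∀ {a b} → Star (Within H D) a b → Star (Within H D⁺) a b
      widen = Star.map λ (e , da , db) → e , inj₁ da , inj₁ db

      attach : ∀ {v} → D v → w ~ v → M y (f v)
      attach dv w~v with unique-attachment H acyclic ¬dw du dv (linked du dv) (~-sym u~w) w~v
      ... | refl = M-sym fu-y

    extendPartial : Partial D⁺
    extendPartial = record
      { f      = f⁺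
      ; linked = linked⁺
      ; inj    = inj⁺
      ; hom    = hom⁺
      ; f-in   = [ (λ dv → subst S (sym (f⁺-D dv)) (f-in dv)) , (λ { refl → subst S (sym f⁺-w) y-in }) ]′
      ; f-side = [ (λ dv → trans (cong σ (f⁺-D dv)) (f-side dv)) , (λ { refl → trans (cong σ f⁺-w) y-side }) ]′
      }
      where
      linked⁺ : ∀ {a b} → D⁺ a → D⁺ b → Star (Within H D⁺) a b
      linked⁺ (inj₁ da)   (inj₁ db)   = widen (linked da db)
      linked⁺ (inj₁ da)   (inj₂ refl) = widen (linked da du) ◅◅ ((u~w , inj₁ du , inj₂ refl) ◅ ε)
      linked⁺ (inj₂ refl) (inj₁ db)   = (~-sym u~w , inj₂ refl , inj₁ du) ◅ widen (linked du db)
      linked⁺ (inj₂ refl) (inj₂ refl) = ε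
      inj⁺ : ∀ {a b} → D⁺ a → D⁺ b → f⁺ a ≡ f⁺ b → a ≡ b
      inj⁺ (inj₁ da)   (inj₁ db)   eq = inj da db (trans (sym (f⁺-D da)) (trans eq (f⁺-D db)))
      inj⁺ (inj₁ da)   (inj₂ refl) eq = contradiction (trans (sym (f⁺-D da)) (trans eq f⁺-w)) (y-new da)
      inj⁺ (inj₂ refl) (inj₁ db)   eq = contradiction (trans (sym (f⁺-D db)) (trans (sym eq) f⁺-w)) (y-new db)
      inj⁺ (inj₂ refl) (inj₂ refl) eq = refl
      hom⁺ : ∀ {a b} → D⁺ a → D⁺ b → a ~ b → M (f⁺ a) (f⁺ b)
      hom⁺ (inj₁ da)   (inj₁ db)   e rewrite f⁺-D da | f⁺-D db = hom da db e
      hom⁺ (inj₁ da)   (inj₂ refl) e rewrite f⁺-D da | f⁺-w    = M-sym (attach da (~-sym e))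
      hom⁺ (inj₂ refl) (inj₁ db)   e rewrite f⁺-w | f⁺-D db    = attach db e
      hom⁺ (inj₂ refl) (inj₂ refl) e = contradiction e ~-irrefl

  embed : ∃ S → Partial (λ _ → ⊤)
  embed (s , ss) = go (count (λ v → ¬? (v ≟ t))) (_≟ t) ≤-refl seed refl
    where
    t = proj₁ (inhabited (σ s))
    seed : Partial (_≡ t)
    seed = record
      { f      = λ _ → s
      ; linked = λ { refl refl → ε }
      ; inj    = λ { refl refl _ → refl }
      ; hom    = λ { refl refl e → contradiction e ~-irrefl }
      ; f-in   = λ _ → ss
      ; f-side = λ { refl → sym (proj₂ (inhabited (σ s))) }
      }
    go : ∀ k {D : Fin n → Set} (D? : Decidable D) → count (λ v → ¬? (D? v)) ≤ k →
         Partial D → D t → Partial (λ _ → ⊤)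
    go k {D} D? rest p dt with any? (λ v → ¬? (D? v))
    ... | no full = record
      { f = f ; linked = λ _ _ → Star.map (λ (e , _ , _) → e , tt , tt) (linked (all _) (all _))
      ; inj = λ _ _ → inj (all _) (all _) ; hom = λ _ _ → hom (all _) (all _)
      ; f-in = λ _ → f-in (all _) ; f-side = λ _ → f-side (all _) }
      where
      open Partial p
      all : ∀ v → D v
      all v with D? v
      ... | yes dv = dv
      ... | no ¬dv = contradiction (v , ¬dv) full
    go zero D? rest p dt | yes (v , ¬dv) =
      contradiction (≤-trans (count-positive (λ v → ¬? (D? v)) ¬dv) rest) λ ()
    go (suc k) {D} D? rest p dt | yes (v , ¬dv) with crossing H D? (connected t v) dt ¬dv
    ... | u , w , u~w , du , ¬dw =
      go k D⁺? (≤-pred (≤-trans (count-strict (λ v → ¬? (D⁺? v)) (λ v → ¬? (D? v))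
                                  (λ _ ¬d → ¬d ∘ inj₁) ¬dw (λ ¬d → ¬d (inj₂ refl))) rest))
         (extendPartial D? p u~w du ¬dw) (inj₁ dt)
      where
      D⁺? : Decidable (λ v → D v ⊎ v ≡ w)
      D⁺? v = D? v ⊎-dec (v ≟ w)

-- Complete bipartite graphs are Ramsey for trees

module CompleteBipartite (a b : ℕ) where

  σ : Fin (a + b) → Bool
  σ u = toℕ u <ᵇ a

  σ? : ∀ c → Decidable (λ u → σ u ≡ c)
  σ? c u = σ u Bool.≟ c

  K : Graph (a + b)
  K = record
    { adj    = λ u v → σ u xor σ v
    ; sym    = λ u v → xor-comm (σ u) (σ v)
    ; irrefl = λ v → xor-same (σ v)
    }

count-<ᵇ : ∀ a b → count (CompleteBipartite.σ? a b true) ≡ a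
count-<ᵇ zero    b = count-none (CompleteBipartite.σ? 0 b true) λ _ ()
count-<ᵇ (suc a) b = cong suc (count-<ᵇ a b)

count-≮ᵇ : ∀ a b → count (CompleteBipartite.σ? a b false) ≡ b
count-≮ᵇ zero    b = count-all (CompleteBipartite.σ? 0 b false) λ _ → refl
count-≮ᵇ (suc a) b = count-≮ᵇ a b

module _ (a b : ℕ) where
  open CompleteBipartite a b
  open GraphProperties K

  sum-by-side : ∀ x y → sum (λ u → if σ u then x else y) ≡ a * x + b * y
  sum-by-side x y = begin
    sum (λ u → if σ u then x else y)
      ≡⟨ sum-cong-≗ split ⟩
    sum (λ u → ind (σ? true u) * x + ind (σ? false u) * y)
      ≡⟨ ∑-distrib-+ (λ u → ind (σ? true u) * x) _ ⟩
    sum (λ u → ind (σ? true u) * x) + sum (λ u → ind (σ? false u) * y)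
      ≡⟨ cong₂ _+_ (*-distribʳ-sum x (λ u → ind (σ? true u))) (*-distribʳ-sum y (λ u → ind (σ? false u))) ⟨
    count (σ? true) * x + count (σ? false) * y
      ≡⟨ cong₂ (λ p q → p * x + q * y) (count-<ᵇ a b) (count-≮ᵇ a b) ⟩
    a * x + b * y ∎
    where
    open ≡-Reasoning
    split : ∀ u → (if σ u then x else y) ≡ ind (σ? true u) * x + ind (σ? false u) * y
    split u with σ u
    ... | true  = sym (trans (+-identityʳ _) (*-identityˡ x))
    ... | false = sym (*-identityˡ y)

  ∑adj-K : sum (λ u → count (λ v → T? (adj u v))) ≡ 2 * (a * b)
  ∑adj-K = begin
    sum (λ u → count (λ v → T? (adj u v))) ≡⟨ sum-cong-≗ row ⟩
    sum (λ u → if σ u then b else a)       ≡⟨ sum-by-side b a ⟩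
    a * b + b * a                          ≡⟨ cong (a * b +_) (trans (*-comm b a) (sym (+-identityʳ _))) ⟩
    2 * (a * b)                            ∎
    where
    open ≡-Reasoning
    row : ∀ u → count (λ v → T? (adj u v)) ≡ (if σ u then b else a)
    row u with σ u
    ... | true  = trans (count-cong (λ v → T? (not (σ v))) (σ? false) (λ v → to v) (λ v → from v)) (count-≮ᵇ a b)
      where
      to : ∀ v → T (not (σ v)) → σ v ≡ false
      to v t with σ v
      ... | false = refl
      from : ∀ v → σ v ≡ false → T (not (σ v))
      from v eq rewrite eq = tt
    ... | false = trans (count-cong (λ v → T? (σ v)) (σ? true) (λ v → Equivalence.to T-≡) (λ v → Equivalence.from T-≡)) (count-<ᵇ a b)

  size-K : size K ≡ a * b
  size-K = *-cancelˡ-≡ (size K) (a * b) 2 (trans 2*size≡∑adj ∑adj-K)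

  adj-opposite : ∀ {u v} → u ~ v → σ v ≡ not (σ u)
  adj-opposite {u} {v} e with σ u | σ v
  ... | true  | false = refl
  ... | false | true  = refl

colour-average : ∀ r n₁ n₂ → 1 ≤ r → 1 ≤ n₁ → 1 ≤ n₂ →
  r * (2 * (2 * r * n₁ * (n₂ ∸ 1) + 2 * r * n₂ * (n₁ ∸ 1))) < 2 * (2 * r * n₁ * (2 * r * n₂))
colour-average (suc r) (suc m₁) (suc m₂) _ _ _ = begin-strict
  suc r * (2 * (2 * suc r * suc m₁ * m₂ + 2 * suc r * suc m₂ * m₁))
    <⟨ m<m+n _ {4 * (suc r * suc r * suc (suc (m₁ + m₂)))} (s≤s z≤n) ⟩
  suc r * (2 * (2 * suc r * suc m₁ * m₂ + 2 * suc r * suc m₂ * m₁)) + 4 * (suc r * suc r * suc (suc (m₁ + m₂)))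
    ≡⟨ identity (suc r) m₁ m₂ ⟩
  2 * (2 * suc r * suc m₁ * (2 * suc r * suc m₂)) ∎
  where
  open ≤-Reasoning
  identity : ∀ r m₁ m₂ → r * (2 * (2 * r * suc m₁ * m₂ + 2 * r * suc m₂ * m₁)) + 4 * (r * r * suc (suc (m₁ + m₂)))
             ≡ 2 * (2 * r * suc m₁ * (2 * r * suc m₂))
  identity = solve-∀

module _ (H : Graph n) (sided : Sided H) (acyclic : Graph.Acyclic H) where
  open Sided sided

  private
    n₁ = classSize true
    n₂ = classSize false

    1≤class : ∀ b → 1 ≤ classSize b
    1≤class b = count-positive (side? b) (proj₂ (inhabited b))

  -- One less than the number of neighbours needed, as dense-subgraph yields <.
  threshold : Bool → ℕ
  threshold true  = n₂ ∸ 1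
  threshold false = n₁ ∸ 1

  module _ (r : ℕ) (6≤r : 6 ≤ r) where
    open CompleteBipartite (2 * r * n₁) (2 * r * n₂)
    open GraphProperties K hiding (Acyclic; Connected)

    weight-small : r * (2 * (2 * r * n₁ * (n₂ ∸ 1) + 2 * r * n₂ * (n₁ ∸ 1))) < 2 * (2 * r * n₁ * (2 * r * n₂))
    weight-small = colour-average r n₁ n₂ (≤-trans (s≤s z≤n) 6≤r) (1≤class true) (1≤class false)

    module _ (c : EdgeColouring r K) where
      open EdgeColouring c using (colour)

      HueEdge : Fin r → Fin _ → Fin _ → Set
      HueEdge h u v = u ~ v × colour u v ≡ h

      hueEdge? : ∀ h u → Decidable (HueEdge h u)
      hueEdge? h u v = T? (adj u v) ×-dec (colour u v ≟ h)

      HueEdge-sym : ∀ h {u v} → HueEdge h u v → HueEdge h v u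
      HueEdge-sym h {u} {v} (e , eq) = ~-sym e , trans (EdgeColouring.sym c v u) eq

      edgesOf : Fin r → ℕ
      edgesOf h = sum (λ u → count (hueEdge? h u))

      ∑edgesOf : 2 * (2 * r * n₁ * (2 * r * n₂)) ≤ sum edgesOf
      ∑edgesOf = begin
        2 * (2 * r * n₁ * (2 * r * n₂))                    ≡⟨ ∑adj-K (2 * r * n₁) (2 * r * n₂) ⟨
        sum (λ u → sum (λ v → ind (T? (adj u v))))         ≤⟨ sum-mono (λ u → sum-mono λ v → coloured u v) ⟩
        sum (λ u → sum (λ v → sum (λ h → ind (hueEdge? h u v)))) ≡⟨ sum-cong-≗ (λ u → ∑-comm (λ v h → ind (hueEdge? h u v))) ⟩
        sum (λ u → sum (λ h → count (hueEdge? h u)))       ≡⟨ ∑-comm (λ u h → count (hueEdge? h u)) ⟩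
        sum edgesOf ∎
        where
        open ≤-Reasoning
        coloured : ∀ u v → ind (T? (adj u v)) ≤ sum (λ h → ind (hueEdge? h u v))
        coloured u v = ≤-trans (ind-mono (T? (adj u v)) (hueEdge? (colour u v) u v) (λ e → e , refl))
                               (term≤sum (λ h → ind (hueEdge? h u v)) (colour u v))

      private
        w : Fin _ → ℕ
        w u = threshold (σ u)
        module D h = DenseSubgraph (hueEdge? h) (HueEdge-sym h) w
        everything? : Decidable {A = Fin (2 * r * n₁ + 2 * r * n₂)} (λ _ → ⊤)
        everything? _ = yes tt

      weight-everything : ∀ h → D.weight h everything? ≡ 2 * r * n₁ * (n₂ ∸ 1) + 2 * r * n₂ * (n₁ ∸ 1)
      weight-everything h = trans (sum-cong-≗ pointwise) (sum-by-side (2 * r * n₁) (2 * r * n₂) (n₂ ∸ 1) (n₁ ∸ 1))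
        where
        pointwise : ∀ u → 1 * w u ≡ (if σ u then n₂ ∸ 1 else n₁ ∸ 1)
        pointwise u with σ u
        ... | true  = *-identityˡ _
        ... | false = *-identityˡ _

      majority : ∃[ h ] 2 * D.weight h everything? < D.pairs h everything?
      majority with any? (λ h → 2 * D.weight h everything? <? D.pairs h everything?)
      ... | yes found = found
      ... | no none = contradiction (begin-strict
        r * (2 * (2 * r * n₁ * (n₂ ∸ 1) + 2 * r * n₂ * (n₁ ∸ 1)))  <⟨ weight-small ⟩
        2 * (2 * r * n₁ * (2 * r * n₂))                            ≤⟨ ∑edgesOf ⟩
        sum edgesOf                                                ≤⟨ sum-mono (λ h → ≤-trans (edges≤pairs h) (small h)) ⟩
        sum {r} (λ _ → 2 * (2 * r * n₁ * (n₂ ∸ 1) + 2 * r * n₂ * (n₁ ∸ 1))) ≡⟨ sum-const r _ ⟩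
        r * (2 * (2 * r * n₁ * (n₂ ∸ 1) + 2 * r * n₂ * (n₁ ∸ 1)))  ∎) (<-irrefl refl)
        where
        open ≤-Reasoning
        small : ∀ h → D.pairs h everything? ≤ 2 * (2 * r * n₁ * (n₂ ∸ 1) + 2 * r * n₂ * (n₁ ∸ 1))
        small h = ≤-trans (≮⇒≥ λ big → none (h , big)) (≤-reflexive (cong (2 *_) (weight-everything h)))
        edges≤pairs : ∀ h → edgesOf h ≤ D.pairs h everything?
        edges≤pairs h = sum-mono λ u → count-mono (hueEdge? h u) (D.pair? h everything? u) λ v e → tt , tt , e

      monochromaticTree : MonochromaticCopy H K c
      monochromaticTree with majority
      ... | h , dense with D.dense-subgraph h everything? dense
      ... | S , S? , rich , nonempty = record
        { hue = h ; embed = f ; injective = inj tt tt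
        ; edge = λ u v e → proj₁ (hom tt tt e) ; mono = λ u v e → proj₂ (hom tt tt e) }
        where
        enough : ∀ u → S u → classSize (not (σ u)) ≤ count (λ v → S? v ×-dec hueEdge? h u v)
        enough u su = ≤-trans (cover (σ u)) (rich u su)
          where
          cover : ∀ b → classSize (not b) ≤ suc (threshold b)
          cover true  = m≤n+m∸n _ 1
          cover false = m≤n+m∸n _ 1
        switches : ∀ {u v} → HueEdge h u v → σ v ≡ not (σ u)
        switches {u} {v} (e , _) = adj-opposite (2 * r * n₁) (2 * r * n₂) {u} {v} e
        open TreeEmbedding H sided acyclic (hueEdge? h) (HueEdge-sym h) S? σ switches enough
        open Partial (embed nonempty)

  completeBipartite-arrows : ∀ r → 6 ≤ r → Arrows r (CompleteBipartite.K (2 * r * n₁) (2 * r * n₂)) H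
  completeBipartite-arrows r 6≤r = monochromaticTree r 6≤r

-- Existence of the minimum

Searchable : (A : Set) → (A → A → Set) → Set₁
Searchable A _≈_ = ∀ {P : A → Set} → (∀ {x y} → x ≈ y → P x → P y) → Decidable P → Dec (∃ P)

search-Fin : Searchable (Fin n) _≡_
search-Fin _ = any?

search-Bool : Searchable Bool _≡_
search-Bool _ P? = map′ [ (true ,_) , (false ,_) ]′
                        (λ { (true , p) → inj₁ p ; (false , p) → inj₂ p })
                        (P? true ⊎-dec P? false)

search-→ : {A : Set} {_≈_ : A → A → Set} → (∀ {x} → x ≈ x) → Searchable A _≈_ →
           ∀ {n} → Searchable (Fin n → A) (λ f g → ∀ i → f i ≈ g i)
search-→ refl′ search {zero}  resp P? = map′ (_ ,_) (λ (f , p) → resp (λ ()) p) (P? λ ())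
search-→ refl′ search {suc n} resp P? = map′
  (λ (a , f , p) → a Vector.∷ f , p)
  (λ (f , p) → f zero , f ∘ suc , resp (λ { zero → refl′ ; (suc i) → refl′ }) p)
  (search (λ a≈b (f , p) → f , resp (λ { zero → a≈b ; (suc i) → refl′ }) p)
          λ a → search-→ refl′ search (λ f≈g → resp λ { zero → refl′ ; (suc i) → f≈g i }) λ f → P? (a Vector.∷ f))

search-→² : {A : Set} → Searchable A _≡_ → ∀ {n} →
            Searchable (Fin n → Fin n → A) (λ f g → ∀ i j → f i j ≡ g i j)
search-→² search = search-→ (λ _ → refl) (search-→ refl search)

symmetric? : (f : Fin n → Fin n → Fin m) → Dec (∀ u v → f u v ≡ f v u)
symmetric? f = all? λ u → all? λ v → f u v ≟ f v u

module _ {n N r : ℕ} (H : Graph n) (G : Graph N) where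
  private
    module H = GraphProperties H
    module G = GraphProperties G

  copy-resp : {c d : EdgeColouring r G} →
              (∀ u v → EdgeColouring.colour c u v ≡ EdgeColouring.colour d u v) →
              MonochromaticCopy H G c → MonochromaticCopy H G d
  copy-resp c≗d copy = record
    { MonochromaticCopy copy ; mono = λ u v e → trans (sym (c≗d _ _)) (MonochromaticCopy.mono copy u v e) }

  copy? : (c : EdgeColouring r G) → Dec (MonochromaticCopy H G c)
  copy? c = map′
    (λ (h , f , inj , e) → record
      { hue = h ; embed = f ; injective = λ {u} {v} → inj u v
      ; edge = λ u v uv → proj₁ (e u v uv) ; mono = λ u v uv → proj₂ (e u v uv) })
    (λ k → let open MonochromaticCopy k in
      hue , embed , (λ u v → injective) , λ u v uv → edge u v uv , mono u v uv)
    (any? λ h → search-→ refl search-Fin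
      (λ {f} {g} f≗g (inj , e) →
        (λ u v gu≡gv → inj u v (trans (f≗g u) (trans gu≡gv (sym (f≗g v))))) ,
        λ u v uv → subst₂ (λ x y → x G.~ y × colour x y ≡ h) (f≗g u) (f≗g v) (e u v uv))
      λ f → (all? λ u → all? λ v → (f u ≟ f v) →-dec (u ≟ v)) ×-dec
            (all? λ u → all? λ v → T? (H.adj u v) →-dec (T? (G.adj (f u) (f v)) ×-dec (colour (f u) (f v) ≟ h))))
    where open EdgeColouring c using (colour)

  BadColouring : (Fin N → Fin N → Fin r) → Set
  BadColouring f = Σ[ c ∈ EdgeColouring r G ]
                     ((∀ u v → EdgeColouring.colour c u v ≡ f u v) × ¬ MonochromaticCopy H G c)

  badColouring? : Decidable BadColouring
  badColouring? f = decide (symmetric? f)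
    where
    decide : Dec (∀ u v → f u v ≡ f v u) → Dec (BadColouring f)
    decide (no asym) = no λ (c , c≗f , _) → asym λ u v →
      trans (sym (c≗f u v)) (trans (EdgeColouring.sym c u v) (c≗f v u))
    decide (yes s) = map′ (λ bad → f-colouring , (λ _ _ → refl) , bad)
                          (λ (c , c≗f , bad) k → bad (copy-resp (λ u v → sym (c≗f u v)) k))
                          (¬? (copy? f-colouring))
      where
      f-colouring : EdgeColouring r G
      f-colouring = record { colour = f ; sym = s }

  arrows? : Dec (Arrows r G H)
  arrows? = map′ (λ good c → decidable-stable (copy? c) λ bad → good (_ , c , (λ _ _ → refl) , bad))
                 no-bad
                 (¬? (search-→² search-Fin {P = BadColouring}
                        (λ f≗g (c , c≗f , bad) → c , (λ u v → trans (c≗f u v) (f≗g u v)) , bad)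
                        badColouring?))
    where
    no-bad : Arrows r G H → ¬ ∃ BadColouring
    no-bad arr (_ , c , _ , bad) = bad (arr c)

NoIsolated : Graph n → Set
NoIsolated H = ∀ u → ∃[ v ] u ~ v
  where open Graph H

arrows-transfer : ∀ {n N N′ r} (H : Graph n) (G : Graph N) (G′ : Graph N′) (φ : Fin N → Fin N′) →
                  NoIsolated H →
                  (∀ {u v} → Graph._~_ G u v → Graph._~_ G′ (φ u) (φ v)) →
                  (∀ {u v u′ v′} → Graph._~_ G u u′ → Graph._~_ G v v′ → φ u ≡ φ v → u ≡ v) →
                  Arrows r G H → Arrows r G′ H
arrows-transfer H G G′ φ full hom inj arr c = record
  { hue = hue ; embed = φ ∘ embed
  ; injective = λ {u} {v} eq → injective (inj (edge u _ (proj₂ (full u))) (edge v _ (proj₂ (full v))) eq)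
  ; edge = λ u v e → hom (edge u v e) ; mono = mono }
  where
  open EdgeColouring c using (colour)
  pullback : EdgeColouring _ G
  pullback = record { colour = λ u v → colour (φ u) (φ v) ; sym = λ u v → EdgeColouring.sym c _ _ }
  open MonochromaticCopy (arr pullback)

deleteVertex : Graph (suc n) → Fin (suc n) → Graph n
deleteVertex G x = record
  { adj    = λ u v → Graph.adj G (punchIn x u) (punchIn x v)
  ; sym    = λ u v → Graph.sym G _ _
  ; irrefl = λ v → Graph.irrefl G _ }

sum-punchIn≤sum : (f : Fin (suc n) → ℕ) (x : Fin (suc n)) → sum (f ∘ punchIn x) ≤ sum f
sum-punchIn≤sum f x = ≤-trans (m≤n+m _ (f x)) (≤-reflexive (sym (sum-remove f)))

size-deleteVertex : (G : Graph (suc n)) (x : Fin (suc n)) → size (deleteVertex G x) ≤ size G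
size-deleteVertex G x = *-cancelˡ-≤ 2 (begin
  2 * size (deleteVertex G x)                                       ≡⟨ 2*size≡∑adj (deleteVertex G x) ⟩
  sum (λ u → sum (λ v → e (punchIn x u) (punchIn x v)))             ≤⟨ sum-mono (λ u → sum-punchIn≤sum (e (punchIn x u)) x) ⟩
  sum (λ u → sum (e (punchIn x u)))                                 ≤⟨ sum-punchIn≤sum (λ u → sum (e u)) x ⟩
  sum (λ u → sum (e u))                                             ≡⟨ 2*size≡∑adj G ⟨
  2 * size G                                                        ∎)
  where
  open ≤-Reasoning
  open GraphProperties
  e : _ → _ → ℕ
  e u v = ind (T? (Graph.adj G u v))

least : {P : ℕ → Set} → Decidable P → ∀ {b} → P b → ∃[ m ] (P m × (∀ k → P k → m ≤ k))
least {P} P? {b} pb = go b 0 (λ _ ()) pb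
  where
  go : ∀ gap m → (∀ k → k < m → ¬ P k) → P (m + gap) → ∃[ m ] (P m × (∀ k → P k → m ≤ k))
  go gap m below p with P? m
  ... | yes pm = m , pm , λ k pk → ≮⇒≥ λ k<m → below k k<m pk
  go zero m below p | no ¬pm = contradiction (subst P (+-identityʳ m) p) ¬pm
  go (suc gap) m below p | no ¬pm = go gap (suc m)
    (λ k k<1+m pk → [ (λ k<m → below k k<m pk) , (λ { refl → ¬pm pk }) ]′ (m≤n⇒m<n∨m≡n (≤-pred k<1+m)))
    (subst P (+-suc m gap) p)

module _ {n} (r : ℕ) (H : Graph n) (full : NoIsolated H) where

  Small : ℕ → Set
  Small m = ∃[ N ] Σ[ G ∈ Graph (toℕ {2 + 2 * m} N) ] (size G ≤ m × Arrows r G H)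

  remove-isolated : ∀ {N} (G : Graph (suc (suc N))) m → ¬ suc (suc N) ≤ 1 + 2 * m →
                    size G ≤ m → Arrows r G H → Σ[ F ∈ Graph (suc N) ] (size F ≤ m × Arrows r F H)
  remove-isolated {N} G m N≰ G≤m arr = decide (any? (λ x → all? (λ v → ¬? (T? (adj x v)))))
    where
    open GraphProperties G
    some : ∀ {u} → ¬ (∀ v → ¬ u ~ v) → 1 ≤ count (λ v → T? (adj u v))
    some {u} lively = decidable-stable (1 ≤? _) λ none → lively λ v e → none (count-positive (λ v → T? (adj u v)) e)
    decide : Dec (∃[ x ] (∀ v → ¬ x ~ v)) → Σ[ F ∈ Graph (suc N) ] (size F ≤ m × Arrows r F H)
    decide (no none) = contradiction (begin
      suc (suc N)                   ≡⟨ *-identityʳ _ ⟨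
      suc (suc N) * 1               ≡⟨ sum-const (suc (suc N)) 1 ⟨
      sum {suc (suc N)} (λ _ → 1)   ≤⟨ sum-mono (λ u → some λ lonely → none (u , lonely)) ⟩
      sum (λ u → count (λ v → T? (adj u v))) ≡⟨ 2*size≡∑adj ⟨
      2 * size G                    ≤⟨ *-monoʳ-≤ 2 G≤m ⟩
      2 * m                         ≤⟨ n≤1+n _ ⟩
      1 + 2 * m                     ∎) N≰
      where open ≤-Reasoning
    decide (yes (x , isolated)) =
      deleteVertex G x , ≤-trans (size-deleteVertex G x) G≤m ,
      arrows-transfer H G (deleteVertex G x) φ full hom inj arr
      where
      φ : Fin (suc (suc N)) → Fin (suc N)
      φ u with x ≟ u
      ... | yes _   = zero
      ... | no x≢u  = punchOut x≢u
      punchIn-φ : ∀ {u v} → u ~ v → punchIn x (φ u) ≡ u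
      punchIn-φ {u} e with x ≟ u
      ... | yes refl = contradiction e (isolated _)
      ... | no x≢u   = F.punchIn-punchOut x≢u
      hom : ∀ {u v} → u ~ v → Graph._~_ (deleteVertex G x) (φ u) (φ v)
      hom e = subst₂ _~_ (sym (punchIn-φ e)) (sym (punchIn-φ (~-sym e))) e
      inj : ∀ {u v u′ v′} → u ~ u′ → v ~ v′ → φ u ≡ φ v → u ≡ v
      inj e e′ eq = trans (sym (punchIn-φ e)) (trans (cong (punchIn x) eq) (punchIn-φ e′))

  shrink : ∀ {N} (G : Graph N) m → size G ≤ m → Arrows r G H → Small m
  shrink {N} G m G≤m arr = decide N G G≤m arr (N ≤? 1 + 2 * m)
    where
    decide : ∀ N (G : Graph N) → size G ≤ m → Arrows r G H → Dec (N ≤ 1 + 2 * m) → Small m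
    decide N G G≤m arr (yes N≤) =
      fromℕ< (s≤s N≤) , subst (λ N → Σ[ G ∈ Graph N ] (size G ≤ m × Arrows r G H))
                               (sym (toℕ-fromℕ< (s≤s N≤))) (G , G≤m , arr)
    decide zero          G G≤m arr (no N≰) = contradiction z≤n N≰
    decide (suc zero)    G G≤m arr (no N≰) = contradiction (s≤s z≤n) N≰
    decide (suc (suc N)) G G≤m arr (no N≰) =
      let F , F≤m , arrF = remove-isolated G m N≰ G≤m arr in decide (suc N) F F≤m arrF (suc N ≤? 1 + 2 * m)

  SmallAdjacency : ∀ {N} → ℕ → (Fin N → Fin N → Bool) → Set
  SmallAdjacency {N} m f =
    Σ[ G ∈ Graph N ] ((∀ u v → Graph.adj G u v ≡ f u v) × (size G ≤ m × Arrows r G H))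

  smallAdjacency? : ∀ {N} m → Decidable (SmallAdjacency {N} m)
  smallAdjacency? {N} m f = decide ((all? λ u → all? λ v → f u v Bool.≟ f v u) ×-dec (all? λ v → f v v Bool.≟ false))
    where
    decide : Dec ((∀ u v → f u v ≡ f v u) × (∀ v → f v v ≡ false)) → Dec (SmallAdjacency m f)
    decide (no bad) = no λ (G , G≗f , _) → bad
      ( (λ u v → trans (sym (G≗f u v)) (trans (Graph.sym G u v) (G≗f v u)))
      , λ v → trans (sym (G≗f v v)) (Graph.irrefl G v))
    decide (yes (s , i)) = map′ (λ p → F , (λ _ _ → refl) , p) same ((size F ≤? m) ×-dec arrows? H F)
      where
      F : Graph N
      F = record { adj = f ; sym = s ; irrefl = i }
      same : SmallAdjacency m f → size F ≤ m × Arrows r F H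
      same (G , G≗f , G≤m , arr) =
        ≤-trans (≤-reflexive (*-cancelˡ-≡ _ _ 2 (trans (GraphProperties.2*size≡∑adj F)
                   (trans (sum-cong-≗ λ u → sum-cong-≗ λ v → cong (λ b → ind (T? b)) (sym (G≗f u v)))
                          (sym (GraphProperties.2*size≡∑adj G)))))) G≤m ,
        arrows-transfer H G F id full (λ {u} {v} → subst T (G≗f u v)) (λ _ _ eq → eq) arr

  small? : Decidable Small
  small? m = any? λ N → map′ (λ (_ , G , _ , p) → G , p) (λ (G , p) → Graph.adj G , G , (λ _ _ → refl) , p)
    (search-→² search-Bool {P = SmallAdjacency m}
      (λ f≗g (G , G≗f , p) → G , (λ u v → trans (G≗f u v) (f≗g u v)) , p)
      (smallAdjacency? m))

  sizeRamsey-exists : ∀ {N} (G : Graph N) → Arrows r G H → ∃[ R ] (IsSizeRamsey r H R × R ≤ size G)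
  sizeRamsey-exists G arr = attained (least small? (shrink G (size G) ≤-refl arr))
    where
    attained : ∃[ m ] (Small m × (∀ k → Small k → m ≤ k)) → ∃[ R ] (IsSizeRamsey r H R × R ≤ size G)
    attained (R , (N , F , F≤R , arrF) , minimal) =
      R , ((_ , F , arrF , ≤-antisym F≤R (lower F arrF)) , λ G → lower G) , lower G arr
      where
      lower : ∀ {N} (G : Graph N) → Arrows r G H → R ≤ size G
      lower G arr = minimal (size G) (shrink G (size G) ≤-refl arr)

-- Greedy edge colouring with bounded colour degrees

count-equal : ∀ {s} {A : Set} (A? : Dec A) (k : ℕ) → count (λ (c : Fin s) → A? ×-dec (k ℕ.≟ toℕ c)) ≤ ind A?
count-equal {s} (yes a) k = count-unique (λ (c : Fin s) → yes a ×-dec (k ℕ.≟ toℕ c))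
                          λ _ _ (_ , p) (_ , q) → toℕ-injective (trans (sym p) q)
count-equal {s} (no ¬a) k = ≤-reflexive (count-none (λ (c : Fin s) → no ¬a ×-dec (k ℕ.≟ toℕ c)) λ _ → ¬a ∘ proj₁)

-- The value s stands for "not yet coloured".
module GreedyColouring {N} {E : Fin N → Fin N → Set} (E? : ∀ u → Decidable (E u))
  (s d : ℕ) (room : ∀ u v → E u v → count (E? u) + count (E? v) < s * d) where

  uses : (Fin N → Fin N → ℕ) → Fin N → ℕ → ℕ
  uses f u c = count (λ w → E? u w ×-dec (f u w ℕ.≟ c))

  record Balanced (f : Fin N → Fin N → ℕ) : Set where
    field
      symmetric : ∀ u v → f u v ≡ f v u
      light     : ∀ u c → c < s → uses f u c ≤ d

  ∑uses≤degree : ∀ f u → sum (λ (c : Fin s) → uses f u (toℕ c)) ≤ count (E? u)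
  ∑uses≤degree f u = sum-swap-mono (λ (c : Fin s) w → ind (E? u w ×-dec (f u w ℕ.≟ toℕ c)))
    (λ c → ≤-refl) (λ w → count-equal {s} (E? u w) (f u w))

  available : ∀ f {u v} → E u v → ∃[ c ] (c < s × uses f u c < d × uses f v c < d)
  available f {u} {v} e = choose (any? λ c → (uses f u (toℕ c) <? d) ×-dec (uses f v (toℕ c) <? d))
    where
    open ≤-Reasoning
    choose : Dec (∃[ c ] (uses f u (toℕ {s} c) < d × uses f v (toℕ c) < d)) → _
    choose (yes (c , p)) = toℕ c , F.toℕ<n c , p
    choose (no none) = contradiction (begin-strict
      s * d                                                  ≡⟨ sum-const s d ⟨
      sum {s} (λ _ → d)                                      ≤⟨ sum-mono full ⟩
      sum {s} (λ c → uses f u (toℕ c) + uses f v (toℕ c))    ≡⟨ ∑-distrib-+ {s} (λ c → uses f u (toℕ c)) _ ⟩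
      sum {s} (λ c → uses f u (toℕ c)) + sum {s} (λ c → uses f v (toℕ c))
                                                             ≤⟨ +-mono-≤ (∑uses≤degree f u) (∑uses≤degree f v) ⟩
      count (E? u) + count (E? v)                            <⟨ room u v e ⟩
      s * d                                                  ∎) (<-irrefl refl)
      where
      full : ∀ c → d ≤ uses f u (toℕ c) + uses f v (toℕ c)
      full c with uses f u (toℕ c) <? d
      ... | no u-full  = ≤-trans (≮⇒≥ u-full) (m≤m+n _ _)
      ... | yes u-free = ≤-trans (≮⇒≥ λ v-free → none (c , u-free , v-free)) (m≤n+m _ (uses f u (toℕ c)))

  module Recolour (f : Fin N → Fin N → ℕ) (u v : Fin N) (c : ℕ) where

    Hit : Fin N → Fin N → Set
    Hit x y = (x ≡ u × y ≡ v) ⊎ (x ≡ v × y ≡ u)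

    hit? : ∀ x y → Dec (Hit x y)
    hit? x y = ((x ≟ u) ×-dec (y ≟ v)) ⊎-dec ((x ≟ v) ×-dec (y ≟ u))

    Hit-sym : ∀ {x y} → Hit x y → Hit y x
    Hit-sym (inj₁ (p , q)) = inj₂ (q , p)
    Hit-sym (inj₂ (p , q)) = inj₁ (q , p)

    f⁺ : Fin N → Fin N → ℕ
    f⁺ x y = if does (hit? x y) then c else f x y

    f⁺-hit : ∀ {x y} → Hit x y → f⁺ x y ≡ c
    f⁺-hit {x} {y} h = cong (if_then c else f x y) (dec-true (hit? x y) h)

    f⁺-miss : ∀ {x y} → ¬ Hit x y → f⁺ x y ≡ f x y
    f⁺-miss {x} {y} ¬h = cong (if_then c else f x y) (dec-false (hit? x y) ¬h)

    f⁺-≡ : ∀ {x y k} → f⁺ x y ≡ k → f x y ≡ k ⊎ (Hit x y × c ≡ k)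
    f⁺-≡ {x} {y} eq = [ (λ h → inj₂ (h , trans (sym (f⁺-hit h)) eq))
                      , (λ ¬h → inj₁ (trans (sym (f⁺-miss ¬h)) eq)) ]′ (toSum (hit? x y))

    f⁺-sym : (∀ x y → f x y ≡ f y x) → ∀ x y → f⁺ x y ≡ f⁺ y x
    f⁺-sym s x y = [ (λ h → trans (f⁺-hit h) (sym (f⁺-hit (Hit-sym h))))
                   , (λ ¬h → trans (f⁺-miss ¬h) (trans (s x y) (sym (f⁺-miss (¬h ∘ Hit-sym))))) ]′ (toSum (hit? x y))

    uses-hit : ∀ x z → (∀ y → Hit x y → y ≡ z) → uses f⁺ x c ≤ uses f x c + 1
    uses-hit x z single = ≤-trans
      (count-⊎ (λ w → E? x w ×-dec (f⁺ x w ℕ.≟ c)) (λ w → E? x w ×-dec (f x w ℕ.≟ c)) (_≟ z)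
        λ w (e , eq) → [ (λ fc → inj₁ (e , fc)) , (λ (h , _) → inj₂ (single w h)) ]′ (f⁺-≡ eq))
      (+-monoʳ-≤ (uses f x c) (count-unique (_≟ z) λ { _ _ refl refl → refl }))

    uses-miss : ∀ x k → (∀ y → Hit x y → c ≢ k) → uses f⁺ x k ≤ uses f x k
    uses-miss x k away = count-mono (λ w → E? x w ×-dec (f⁺ x w ℕ.≟ k)) (λ w → E? x w ×-dec (f x w ℕ.≟ k))
      λ w (e , eq) → e , [ id , (λ (h , c≡k) → contradiction c≡k (away w h)) ]′ (f⁺-≡ eq)

    recolour-balanced : Balanced f → uses f u c < d → uses f v c < d → Balanced f⁺
    recolour-balanced bal u-free v-free = record { symmetric = f⁺-sym symmetric ; light = light⁺ }
      where
      open Balanced bal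
      suc≤d : ∀ {a} → a < d → a + 1 ≤ d
      suc≤d {a} a<d = ≤-trans (≤-reflexive (+-comm a 1)) a<d
      light-c : ∀ x → Dec (x ≡ u) → Dec (x ≡ v) → c < s → uses f⁺ x c ≤ d
      light-c x (yes refl) _ c<s = ≤-trans
        (uses-hit u v λ { _ (inj₁ (_ , eq)) → eq ; _ (inj₂ (u≡v , y≡u)) → trans y≡u u≡v }) (suc≤d u-free)
      light-c x (no x≢u) (yes refl) c<s = ≤-trans
        (uses-hit v u λ { _ (inj₁ (v≡u , _)) → contradiction v≡u x≢u ; _ (inj₂ (_ , eq)) → eq }) (suc≤d v-free)
      light-c x (no x≢u) (no x≢v) c<s = ≤-trans
        (uses-miss x c λ { _ (inj₁ (x≡u , _)) → contradiction x≡u x≢u ; _ (inj₂ (x≡v , _)) → contradiction x≡v x≢v })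
        (light x c c<s)
      light⁺ : ∀ x k → k < s → uses f⁺ x k ≤ d
      light⁺ x k k<s = [ (λ c≡k → subst (λ k → k < s → uses f⁺ x k ≤ d) c≡k (light-c x (x ≟ u) (x ≟ v)) k<s)
                       , (λ c≢k → ≤-trans (uses-miss x k λ _ _ → c≢k) (light x k k<s)) ]′ (toSum (c ℕ.≟ k))

  Coloured : (Fin N → Fin N → ℕ) → Fin N × Fin N → Set
  Coloured f (u , v) = E u v → f u v < s

  colour-all : (ps : List (Fin N × Fin N)) → ∃[ f ] (Balanced f × All (Coloured f) ps)
  colour-all List.[] = (λ _ _ → s) , record { symmetric = λ _ _ → refl ; light = unused } , []
    where
    unused : ∀ u c → c < s → count (λ w → E? u w ×-dec (s ℕ.≟ c)) ≤ d
    unused u c c<s = ≤-trans (≤-reflexive (count-none (λ w → E? u w ×-dec (s ℕ.≟ c)) λ _ (_ , eq) → <⇒≢ c<s (sym eq))) z≤n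
  colour-all ((u , v) List.∷ ps) = insert (colour-all ps)
    where
    insert : ∃[ f ] (Balanced f × All (Coloured f) ps) → ∃[ f ] (Balanced f × All (Coloured f) ((u , v) List.∷ ps))
    insert (f , bal , done) with E? u v
    ... | no ¬e = f , bal , (λ e → contradiction e ¬e) ∷ done
    ... | yes e with available f e
    ... | c , c<s , u-free , v-free =
      f⁺ , recolour-balanced bal u-free v-free , (λ _ → <s (inj₁ (f⁺-hit (inj₁ (refl , refl))))) ∷ All.map keep done
      where
      open Recolour f u v c
      <s : ∀ {k} → k ≡ c ⊎ k < s → k < s
      <s (inj₁ refl) = c<s
      <s (inj₂ k<s)  = k<s
      keep : ∀ {p} → Coloured f p → Coloured f⁺ p
      keep {x , y} old e = [ (λ h → <s (inj₁ (f⁺-hit h))) , (λ ¬h → subst (_< s) (sym (f⁺-miss ¬h)) (old e)) ]′ (toSum (hit? x y))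

  greedy-colouring : ∃[ f ] (Balanced f × (∀ u v → E u v → f u v < s))
  greedy-colouring with colour-all (cartesianProduct (allFin N) (allFin N))
  ... | f , bal , done = f , bal , λ u v → All.lookup done (∈-cartesianProduct⁺ (∈-allFin u) (∈-allFin v))

-- The lower bound

<-suc-/ : ∀ r k .{{_ : NonZero k}} → r < suc (r div k) * k
<-suc-/ r k = begin-strict
  r                   ≡⟨ m≡m%n+[m/n]*n r k ⟩
  r mod k + r div k * k   <⟨ +-monoˡ-< _ (m%n<n r k) ⟩
  suc (r div k) * k     ∎
  where open ≤-Reasoning

2*[r/16]<1+r/3 : ∀ r → 2 * (r div 16) < suc (r div 3)
2*[r/16]<1+r/3 r = *-cancelʳ-< 3 _ _ (begin-strict
  2 * (r div 16) * 3   ≡⟨ trans (cong (_* 3) (*-comm 2 (r div 16))) (*-assoc (r div 16) 2 3) ⟩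
  r div 16 * 6         ≤⟨ *-monoʳ-≤ (r div 16) (m≤m+n 6 10) ⟩
  r div 16 * 16        ≤⟨ m/n*n≤m r 16 ⟩
  r                  <⟨ <-suc-/ r 3 ⟩
  suc (r div 3) * 3    ∎)
  where open ≤-Reasoning

palette-fits : ∀ r → 6 ≤ r → suc (r div 3) + (r div 16 + r div 6) < r
palette-fits r 6≤r = *-cancelʳ-< 48 (suc (r div 3) + (r div 16 + r div 6)) r (begin-strict
  (suc (r div 3) + (r div 16 + r div 6)) * 48                     ≡⟨ regroup (r div 3) (r div 16) (r div 6) ⟩
  48 + (r div 3 * 3 * 16 + (r div 16 * 16 * 3 + r div 6 * 6 * 8)) ≤⟨ +-monoʳ-≤ 48 (+-mono-≤ (*-monoˡ-≤ 16 (m/n*n≤m r 3))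
                                                                 (+-mono-≤ (*-monoˡ-≤ 3 (m/n*n≤m r 16)) (*-monoˡ-≤ 8 (m/n*n≤m r 6)))) ⟩
  48 + (r * 16 + (r * 3 + r * 8))                           <⟨ +-monoˡ-< (r * 16 + (r * 3 + r * 8)) (≤-trans (m≤m+n 49 77) (*-monoˡ-≤ 21 6≤r)) ⟩
  r * 21 + (r * 16 + (r * 3 + r * 8))                       ≡⟨ total r ⟩
  r * 48                                                    ∎)
  where
  open ≤-Reasoning
  regroup : ∀ a b c → (suc a + (b + c)) * 48 ≡ 48 + (a * 3 * 16 + (b * 16 * 3 + c * 6 * 8))
  regroup = solve-∀
  total : ∀ r → r * 21 + (r * 16 + (r * 3 + r * 8)) ≡ r * 48
  total = solve-∀

+-≤-cancel : ∀ {a b c e} → a ≤ c → b ≤ e → a + b ≡ c + e → a ≡ c × b ≡ e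
+-≤-cancel {a} {b} {c} {e} a≤c b≤e eq = a≡c , +-cancelˡ-≡ a b e (trans eq (cong (_+ e) (sym a≡c)))
  where
  a≡c : a ≡ c
  a≡c = ≤-antisym a≤c (+-cancelʳ-≤ e c a (≤-trans (≤-reflexive (sym eq)) (+-monoʳ-≤ a b≤e)))

-- d + 1 is the maximum degree on side b, and p is the size of a block.
module AvoidingColouring {n N} (H : Graph n) (sided : Sided H) (b : Bool) (G : Graph N)
  (r d p : ℕ) {{_ : NonZero r}} {{_ : NonZero d}} {{_ : NonZero p}} (6≤r : 6 ≤ r)
  (t₀ : Fin n) (t₀-side : Sided.side sided t₀ ≡ b) (t₀-degree : Graph.degree H t₀ ≡ suc d)
  (n≤3p : Sided.classSize sided b ≤ 3 * p) (2p≤n : 2 * p ≤ Sided.classSize sided b)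
  (few-edges : 1152 * size G < r * r * (Sided.classSize sided b * suc d))
  where

  open Sided sided
  private
    module H = GraphProperties H
    open GraphProperties G

    s : ℕ
    s = suc (r div 3)

  High : Fin N → Set
  High v = r * suc d ≤ 12 * degree v

  high? : Decidable High
  high? v = r * suc d ≤? 12 * degree v

  block : Fin N → ℕ
  block v = rank high? v div p

  few-high : 48 * count high? < r * classSize b
  few-high = *-cancelʳ-< (r * suc d) _ _ (begin-strict
    48 * count high? * (r * suc d)              ≡⟨ *-assoc 48 (count high?) _ ⟩
    48 * (count high? * (r * suc d))            ≡⟨ cong (48 *_) (*-distribʳ-sum (r * suc d) (λ v → ind (high? v))) ⟩
    48 * sum (λ v → ind (high? v) * (r * suc d)) ≤⟨ *-monoʳ-≤ 48 (sum-mono (λ v → charge v (high? v))) ⟩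
    48 * sum (λ v → 12 * degree v)              ≡⟨ cong (48 *_) (*-distribˡ-sum 12 degree) ⟨
    48 * (12 * sum degree)                      ≡⟨ cong (λ z → 48 * (12 * z)) ∑degree≡2*size ⟩
    48 * (12 * (2 * size G))                    ≡⟨ numerals (size G) ⟩
    1152 * size G                               <⟨ few-edges ⟩
    r * r * (classSize b * suc d)               ≡⟨ regroup r (classSize b) (suc d) ⟩
    r * classSize b * (r * suc d)               ∎)
    where
    open ≤-Reasoning
    charge : ∀ v (h : Dec (High v)) → ind h * (r * suc d) ≤ 12 * degree v
    charge v (yes h) = ≤-trans (≤-reflexive (*-identityˡ _)) h
    charge v (no _)  = z≤n
    numerals : ∀ e → 48 * (12 * (2 * e)) ≡ 1152 * e
    numerals = solve-∀
    regroup : ∀ r c k → r * r * (c * k) ≡ r * c * (r * k)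
    regroup = solve-∀

  count-high : count high? ≤ suc (r div 16) * p
  count-high = *-cancelˡ-≤ 48 (begin
    48 * count high?                 ≤⟨ <⇒≤ few-high ⟩
    r * classSize b                  ≤⟨ *-mono-≤ (<⇒≤ (<-suc-/ r 16)) n≤3p ⟩
    suc (r div 16) * 16 * (3 * p)      ≡⟨ regroup (suc (r div 16)) p ⟩
    48 * (suc (r div 16) * p)          ∎)
    where
    open ≤-Reasoning
    regroup : ∀ q p → q * 16 * (3 * p) ≡ 48 * (q * p)
    regroup = solve-∀

  block≤ : ∀ {v} → High v → block v ≤ r div 16
  block≤ hv = ≤-pred (m<n*o⇒m/o<n (<-≤-trans (rank<count high? hv) count-high))

  low-degree : ∀ {v} → ¬ High v → 6 * degree v < r * d
  low-degree {v} low = *-cancelˡ-< 2 _ _ (begin-strict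
    2 * (6 * degree v)  ≡⟨ *-assoc 2 6 (degree v) ⟨
    12 * degree v       <⟨ ≰⇒> low ⟩
    r * suc d           ≤⟨ *-monoʳ-≤ r (+-monoˡ-≤ d (>-nonZero⁻¹ d)) ⟩
    r * (d + d)         ≡⟨ double r d ⟩
    2 * (r * d)         ∎)
    where
    open ≤-Reasoning
    double : ∀ r d → r * (d + d) ≡ 2 * (r * d)
    double = solve-∀

  highNeighbour? : ∀ v → Decidable (λ u → v ~ u × High u)
  highNeighbour? v u = T? (adj v u) ×-dec high? u

  slot : Fin N → Fin N → ℕ
  slot v u = rank (highNeighbour? v) u div d

  slot≤ : ∀ {v u} → ¬ High v → v ~ u → High u → slot v u ≤ r div 6
  slot≤ {v} {u} low vu hu = ≤-pred (m<n*o⇒m/o<n (*-cancelˡ-< 6 _ _ (begin-strict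
    6 * rank (highNeighbour? v) u     ≤⟨ *-monoʳ-≤ 6 (<⇒≤ (rank<count (highNeighbour? v) (vu , hu))) ⟩
    6 * count (highNeighbour? v)      ≤⟨ *-monoʳ-≤ 6 (count-mono (highNeighbour? v) (λ w → T? (adj v w)) (λ _ → proj₁)) ⟩
    6 * count (λ w → T? (adj v w))    ≡⟨ cong (6 *_) (degree≡count v) ⟨
    6 * degree v                      <⟨ low-degree low ⟩
    r * d                             ≤⟨ *-monoˡ-≤ d (<⇒≤ (<-suc-/ r 6)) ⟩
    suc (r div 6) * 6 * d               ≡⟨ regroup (suc (r div 6)) d ⟩
    6 * (suc (r div 6) * d)             ∎)))
    where
    open ≤-Reasoning
    regroup : ∀ q d → q * 6 * d ≡ 6 * (q * d)
    regroup = solve-∀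

  -- Both summands are monotone in the vertex, so the sum determines them.
  block+slot-injective : ∀ v {x y} → block x + slot v x ≡ block y + slot v y →
                         block x ≡ block y × slot v x ≡ slot v y
  block+slot-injective v {x} {y} eq with F.≤-total x y
  ... | inj₁ x≤y = +-≤-cancel (/-monoˡ-≤ p (rank-mono high? x≤y)) (/-monoˡ-≤ d (rank-mono (highNeighbour? v) x≤y)) eq
  ... | inj₂ y≤x =
    let p , q = +-≤-cancel (/-monoˡ-≤ _ (rank-mono high? y≤x)) (/-monoˡ-≤ d (rank-mono (highNeighbour? v) y≤x)) (sym eq)
    in sym p , sym q

  LowEdge : Fin N → Fin N → Set
  LowEdge u v = u ~ v × ¬ High u × ¬ High v

  lowEdge? : ∀ u → Decidable (LowEdge u)
  lowEdge? u v = T? (adj u v) ×-dec (¬? (high? u) ×-dec ¬? (high? v))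

  room : ∀ u v → LowEdge u v → count (lowEdge? u) + count (lowEdge? v) < s * d
  room u v (_ , lu , lv) = *-cancelˡ-< 6 _ _ (begin-strict
    6 * (count (lowEdge? u) + count (lowEdge? v)) ≤⟨ *-monoʳ-≤ 6 (+-mono-≤ (low≤ u) (low≤ v)) ⟩
    6 * (degree u + degree v)                     ≡⟨ *-distribˡ-+ 6 (degree u) (degree v) ⟩
    6 * degree u + 6 * degree v                   <⟨ +-mono-< (low-degree lu) (low-degree lv) ⟩
    r * d + r * d                                 ≤⟨ +-mono-≤ (*-monoˡ-≤ d (<⇒≤ (<-suc-/ r 3))) (*-monoˡ-≤ d (<⇒≤ (<-suc-/ r 3))) ⟩
    s * 3 * d + s * 3 * d                         ≡⟨ regroup s d ⟩
    6 * (s * d)                                   ∎)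
    where
    open ≤-Reasoning
    low≤ : ∀ u → count (lowEdge? u) ≤ degree u
    low≤ u = ≤-trans (count-mono (lowEdge? u) (λ w → T? (adj u w)) (λ _ → proj₁)) (≤-reflexive (sym (degree≡count u)))
    regroup : ∀ s d → s * 3 * d + s * 3 * d ≡ 6 * (s * d)
    regroup = solve-∀

  module Greedy = GreedyColouring lowEdge? s d room

  greedy : Fin N → Fin N → ℕ
  greedy = proj₁ Greedy.greedy-colouring

  greedy-balanced : Greedy.Balanced greedy
  greedy-balanced = proj₁ (proj₂ Greedy.greedy-colouring)

  greedy<s : ∀ {u v} → LowEdge u v → greedy u v < s
  greedy<s e = proj₂ (proj₂ Greedy.greedy-colouring) _ _ e

  value : ∀ u v → Dec (High u) → Dec (High v) → ℕ
  value u v (yes _) (yes _) = block u + block v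
  value u v (yes _) (no _)  = s + (block u + slot v u)
  value u v (no _)  (yes _) = s + (block v + slot u v)
  value u v (no _)  (no _)  = greedy u v

  val : Fin N → Fin N → ℕ
  val u v = value u v (high? u) (high? v)

  val-sym : ∀ u v → val u v ≡ val v u
  val-sym u v = go (high? u) (high? v)
    where
    go : ∀ du dv → value u v du dv ≡ value v u dv du
    go (yes _) (yes _) = +-comm (block u) (block v)
    go (yes _) (no _)  = refl
    go (no _)  (yes _) = refl
    go (no _)  (no _)  = Greedy.Balanced.symmetric greedy-balanced u v

  s≤r : s ≤ r
  s≤r = ≤-trans (m≤m+n s _) (<⇒≤ (palette-fits r 6≤r))

  high-high<s : ∀ {u v} → High u → High v → block u + block v < s
  high-high<s {u} {v} hu hv = ≤-<-trans
    (≤-trans (+-mono-≤ (block≤ hu) (block≤ hv)) (≤-reflexive (cong (r div 16 +_) (sym (+-identityʳ _)))))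
    (2*[r/16]<1+r/3 r)

  mixed<r : ∀ {u v} → High u → ¬ High v → v ~ u → s + (block u + slot v u) < r
  mixed<r hu lv vu = ≤-<-trans (+-monoʳ-≤ s (+-mono-≤ (block≤ hu) (slot≤ lv vu hu))) (palette-fits r 6≤r)

  val<r : ∀ {u v} → u ~ v → val u v < r
  val<r {u} {v} e = go (high? u) (high? v)
    where
    go : ∀ du dv → value u v du dv < r
    go (yes hu) (yes hv) = <-≤-trans (high-high<s hu hv) s≤r
    go (yes hu) (no lv)  = mixed<r hu lv (~-sym e)
    go (no lu)  (yes hv) = mixed<r hv lu e
    go (no lu)  (no lv)  = <-≤-trans (greedy<s (e , lu , lv)) s≤r

  colouring : EdgeColouring r G
  colouring = record
    { colour = λ u v → fromℕ< (m%n<n (val u v) r)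
    ; sym    = λ u v → F.fromℕ<-cong _ _ (cong (_mod r) (val-sym u v)) _ _ }

  module Refute (copy : MonochromaticCopy H G colouring) where
    open MonochromaticCopy copy renaming (embed to f; edge to f-edge)

    h : ℕ
    h = toℕ hue

    val≡h : ∀ {u v} → u H.~ v → val (f u) (f v) ≡ h
    val≡h {u} {v} e = begin
      val (f u) (f v)      ≡⟨ m<n⇒m%n≡m (val<r (f-edge u v e)) ⟨
      val (f u) (f v) mod r  ≡⟨ toℕ-fromℕ< _ ⟨
      toℕ (fromℕ< (m%n<n (val (f u) (f v)) r)) ≡⟨ cong toℕ (mono u v e) ⟩
      h ∎
      where open ≡-Reasoning

    data EdgeType (u v : Fin n) : Set where
      high-high : High (f u) → High (f v) → h < s → block (f u) + block (f v) ≡ h → EdgeType u v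
      high-low  : High (f u) → ¬ High (f v) → s ≤ h → s + (block (f u) + slot (f v) (f u)) ≡ h → EdgeType u v
      low-high  : ¬ High (f u) → High (f v) → s ≤ h → s + (block (f v) + slot (f u) (f v)) ≡ h → EdgeType u v
      low-low   : ¬ High (f u) → ¬ High (f v) → h < s → greedy (f u) (f v) ≡ h → EdgeType u v

    edgeType : ∀ {u v} → u H.~ v → EdgeType u v
    edgeType {u} {v} e = go (high? (f u)) (high? (f v)) (val≡h e)
      where
      go : ∀ du dv → value (f u) (f v) du dv ≡ h → EdgeType u v
      go (yes hu) (yes hv) eq = high-high hu hv (subst (_< s) eq (high-high<s hu hv)) eq
      go (yes hu) (no lv)  eq = high-low hu lv (≤-trans (m≤m+n s _) (≤-reflexive eq)) eq
      go (no lu)  (yes hv) eq = low-high lu hv (≤-trans (m≤m+n s _) (≤-reflexive eq)) eq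
      go (no lu)  (no lv)  eq = low-low lu lv (subst (_< s) eq (greedy<s (f-edge u v e , lu , lv))) eq

    follow : {I : Fin n → Set} → (∀ {u v} → u H.~ v → I u → I v) → ∀ {u v} → Star H._~_ u v → I u → I v
    follow step ε        i = i
    follow step (e ◅ es) i = follow step es (step e i)

    count-image : {P : Fin n → Set} {Q : Fin N → Set} (P? : Decidable P) (Q? : Decidable Q) →
                  (∀ v → P v → Q (f v)) → count P? ≤ count Q?
    count-image P? Q? P⇒Q = count-injection P? Q? (λ v x → f v ≟ x) (λ v pv → f v , P⇒Q v pv , refl)
                              λ eq eq′ → injective (trans eq (sym eq′))

    block≡? : ∀ i → Decidable (λ x → High x × block x ≡ i)
    block≡? i x = high? x ×-dec (block x ℕ.≟ i)

    p<classSize : p < classSize b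
    p<classSize = <-≤-trans (m<m+n p (>-nonZero⁻¹ p)) (≤-trans (≤-reflexive (cong (p +_) (sym (+-identityʳ p)))) 2p≤n)

    too-many-neighbours : {Q : Fin N → Set} (Q? : Decidable Q) → (∀ w → t₀ H.~ w → Q (f w)) → ¬ count Q? ≤ d
    too-many-neighbours Q? nbr≤ = <⇒≱ (≤-trans
      (≤-reflexive (trans (sym t₀-degree) (H.degree≡count t₀)))
      (count-image (λ w → T? (H.adj t₀ w)) Q? nbr≤))

    low-small-hue : ¬ High (f t₀) → ¬ h < s
    low-small-hue low h<s = too-many-neighbours (λ x → lowEdge? (f t₀) x ×-dec (greedy (f t₀) x ℕ.≟ h)) nbr
      (Greedy.Balanced.light greedy-balanced (f t₀) h h<s)
      where
      nbr : ∀ w → t₀ H.~ w → LowEdge (f t₀) (f w) × greedy (f t₀) (f w) ≡ h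
      nbr w e with edgeType e
      ... | high-high hu _ _ _  = contradiction hu low
      ... | high-low hu _ _ _   = contradiction hu low
      ... | low-high _ _ s≤h _  = contradiction s≤h (<⇒≱ h<s)
      ... | low-low lu lv _ eq  = (f-edge t₀ w e , lu , lv) , eq

    low-large-hue : ¬ High (f t₀) → ¬ s ≤ h
    low-large-hue low s≤h = too-many-neighbours
      (λ x → highNeighbour? (f t₀) x ×-dec (slot (f t₀) x ℕ.≟ slot (f t₀) (f w₀))) nbr
      (count-rank-window (highNeighbour? (f t₀)) d _)
      where
      w₀ = proj₁ (neighbour t₀)
      into : ∀ {w} → t₀ H.~ w → High (f w) × s + (block (f w) + slot (f t₀) (f w)) ≡ h
      into e with edgeType e
      ... | high-high hu _ _ _  = contradiction hu low
      ... | high-low hu _ _ _   = contradiction hu low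
      ... | low-high _ hv _ eq  = hv , eq
      ... | low-low _ _ h<s _   = contradiction s≤h (<⇒≱ h<s)
      nbr : ∀ w → t₀ H.~ w → (f t₀ ~ f w × High (f w)) × slot (f t₀) (f w) ≡ slot (f t₀) (f w₀)
      nbr w e = (f-edge t₀ w e , proj₁ (into e)) ,
        proj₂ (block+slot-injective (f t₀) {f w} {f w₀} (+-cancelˡ-≡ s _ _
          (trans (proj₂ (into e)) (sym (proj₂ (into (proj₂ (neighbour t₀))))))))

    high-small-hue : High (f t₀) → ¬ h < s
    high-small-hue high h<s = <⇒≱ n>classSize two-blocks
      where
      i = block (f t₀)
      InTwo : Fin n → Set
      InTwo u = High (f u) × (block (f u) ≡ i ⊎ i + block (f u) ≡ h)
      step : ∀ {u v} → u H.~ v → InTwo u → InTwo v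
      step {u} {v} e (hu , at) with edgeType e
      ... | high-low _ _ s≤h _ = contradiction s≤h (<⇒≱ h<s)
      ... | low-high lu _ _ _  = contradiction hu lu
      ... | low-low lu _ _ _   = contradiction hu lu
      ... | high-high _ hv _ eq = hv , [ (λ u≡i → inj₂ (trans (cong (_+ block (f v)) (sym u≡i)) eq))
                                       , (λ iu≡h → inj₁ (+-cancelˡ-≡ (block (f u)) _ _
                                                     (trans eq (trans (sym iu≡h) (+-comm i _))))) ]′ at
      everywhere : ∀ v → InTwo v
      everywhere v = follow step (connected t₀ v) (high , inj₁ refl)
      n>classSize : classSize b < count {n} (λ _ → yes tt)
      n>classSize = count-strict (side? b) (λ _ → yes tt) _ {proj₁ (neighbour t₀)} tt
        λ eq → not-¬ refl (trans (sym eq) (trans (opposite (proj₂ (neighbour t₀))) (cong not t₀-side)))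
      two-blocks : count {n} (λ _ → yes tt) ≤ classSize b
      two-blocks = begin
        count {n} (λ _ → yes tt)
          ≤⟨ count-image (λ _ → yes tt) (λ x → block≡? i x ⊎-dec block≡? (h ∸ i) x)
               (λ v _ → let hv , at = everywhere v in
                 [ (λ eq → inj₁ (hv , eq)) , (λ eq → inj₂ (hv , m+n≡o⇒n≡o∸m i eq)) ]′ at) ⟩
        count (λ x → block≡? i x ⊎-dec block≡? (h ∸ i) x)
          ≤⟨ count-⊎ (λ x → block≡? i x ⊎-dec block≡? (h ∸ i) x) (block≡? i) (block≡? (h ∸ i)) (λ _ → id) ⟩
        count (block≡? i) + count (block≡? (h ∸ i))
          ≤⟨ +-mono-≤ (count-rank-window high? p i) (count-rank-window high? p (h ∸ i)) ⟩
        p + p                 ≡⟨ cong (p +_) (+-identityʳ p) ⟨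
        2 * p                 ≤⟨ 2p≤n ⟩
        classSize b           ∎
        where
        open ≤-Reasoning
        m+n≡o⇒n≡o∸m : ∀ m {n o} → m + n ≡ o → n ≡ o ∸ m
        m+n≡o⇒n≡o∸m m {n} refl = sym (m+n∸m≡n m n)

    high-large-hue : High (f t₀) → ¬ s ≤ h
    high-large-hue high s≤h = <⇒≱ p<classSize (≤-trans
      (count-image (side? b) (block≡? i) λ v sv → on-side sv (everywhere v))
      (count-rank-window high? p i))
      where
      i = block (f t₀)
      data Inv (v : Fin n) : Set where
        here-high : side v ≡ b → High (f v) → block (f v) ≡ i → Inv v
        here-low  : side v ≡ not b → (∀ w → v H.~ w → High (f w) × block (f w) ≡ i) → Inv v
      step : ∀ {u v} → u H.~ v → Inv u → Inv v
      step {u} e (here-low su nbrs) =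
        here-high (trans (opposite e) (trans (cong not su) (not-involutive b))) (proj₁ (nbrs _ e)) (proj₂ (nbrs _ e))
      step {u} {v} e (here-high su hu at) with edgeType e
      ... | high-high _ _ h<s _ = contradiction s≤h (<⇒≱ h<s)
      ... | low-high lu _ _ _   = contradiction hu lu
      ... | low-low lu _ _ _    = contradiction hu lu
      ... | high-low _ lv _ eq  = here-low (trans (opposite e) (cong not su)) nbrs
        where
        nbrs : ∀ w → v H.~ w → High (f w) × block (f w) ≡ i
        nbrs w e′ with edgeType e′
        ... | high-high hv _ _ _ = contradiction hv lv
        ... | high-low hv _ _ _  = contradiction hv lv
        ... | low-low _ _ h<s _  = contradiction s≤h (<⇒≱ h<s)
        ... | low-high _ hw _ eq′ = hw , trans
          (proj₁ (block+slot-injective (f v) {f w} {f u} (+-cancelˡ-≡ s _ _ (trans eq′ (sym eq))))) at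
      everywhere : ∀ v → Inv v
      everywhere v = follow step (connected t₀ v) (here-high t₀-side high refl)
      on-side : ∀ {v} → side v ≡ b → Inv v → High (f v) × block (f v) ≡ i
      on-side sv (here-high _ hv at) = hv , at
      on-side sv (here-low sv′ _)    = contradiction (trans (sym sv) sv′) (not-¬ refl)

    impossible : ⊥
    impossible = go (high? (f t₀)) (h <? s)
      where
      go : Dec (High (f t₀)) → Dec (h < s) → ⊥
      go (yes high) (yes h<s) = high-small-hue high h<s
      go (yes high) (no h≮s)  = high-large-hue high (≮⇒≥ h≮s)
      go (no low)   (yes h<s) = low-small-hue low h<s
      go (no low)   (no h≮s)  = low-large-hue low (≮⇒≥ h≮s)

  not-arrows : ¬ Arrows r G H
  not-arrows arr = Refute.impossible (arr colouring)

-- Bipartite trees, in the notation of the paper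

module _ (H : Graph n) {n₁ n₂ Δ₁ Δ₂} (bip : IsBipartite H n₁ n₂ Δ₁ Δ₂) where
  open GraphProperties H
  private
    module B = IsBipartite bip
    open B using (V₁; V₁→V₂; V₂→V₁; maxDeg₁; maxDeg₂)

    lookup-∁ : ∀ v → lookup (∁ V₁) v ≡ not (lookup V₁ v)
    lookup-∁ v = lookup-map v not V₁

    ∈∁⇒false : ∀ {v} → v ∈ ∁ V₁ → lookup V₁ v ≡ false
    ∈∁⇒false {v} v∈ = not-injective (trans (sym (lookup-∁ v)) ([]=⇒lookup v∈))

    false⇒∈∁ : ∀ {v} → lookup V₁ v ≡ false → v ∈ ∁ V₁
    false⇒∈∁ {v} eq = lookup⇒[]= v (∁ V₁) (trans (lookup-∁ v) (cong not eq))

  sided : Sided H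
  sided = record
    { side = lookup V₁ ; opposite = λ {u} {v} e → opposite e (lookup V₁ u) refl
    ; connected = B.connected ; inhabited = inhabited }
    where
    opposite : ∀ {u v} → u ~ v → ∀ b → lookup V₁ u ≡ b → lookup V₁ v ≡ not (lookup V₁ u)
    opposite {u} {v} e true  eq = trans (∈∁⇒false (V₁→V₂ u v e (lookup⇒[]= u V₁ eq))) (cong not (sym eq))
    opposite {u} {v} e false eq = trans ([]=⇒lookup (V₂→V₁ u v e (false⇒∈∁ eq))) (cong not (sym eq))
    inhabited : ∀ b → ∃[ v ] lookup V₁ v ≡ b
    inhabited true  = let (v , v∈ , _) , _ = maxDeg₁ in v , []=⇒lookup v∈
    inhabited false = let (v , v∈ , _) , _ = maxDeg₂ in v , ∈∁⇒false v∈

  open Sided sided using (side; side?; classSize)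

  Δ : Bool → ℕ
  Δ true  = Δ₁
  Δ false = Δ₂

  maxDegree : ∀ b → (∃[ v ] (side v ≡ b × degree v ≡ Δ b)) × (∀ v → side v ≡ b → degree v ≤ Δ b)
  maxDegree true  = let (v , v∈ , eq) , max = maxDeg₁ in
    (v , []=⇒lookup v∈ , eq) , λ v sv → max v (lookup⇒[]= v V₁ sv)
  maxDegree false = let (v , v∈ , eq) , max = maxDeg₂ in
    (v , ∈∁⇒false v∈ , eq) , λ v sv → max v (false⇒∈∁ sv)

  classSize-true : classSize true ≡ n₁
  classSize-true = trans (sym (∣∣≡count V₁)) B.∣V₁∣

  classSize-false : classSize false ≡ n₂
  classSize-false = trans (count-cong (side? false) (λ v → lookup (∁ V₁) v Bool.≟ true)
      (λ v eq → []=⇒lookup (false⇒∈∁ eq)) (λ v eq → ∈∁⇒false (lookup⇒[]= v (∁ V₁) eq)))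
    (trans (sym (∣∣≡count (∁ V₁))) B.∣V₂∣)

  module _ (not-star : ¬ IsStar H) (r : ℕ) (6≤r : 6 ≤ r) where

    2≤Δ : ∀ b → 2 ≤ Δ b
    2≤Δ b = ≰⇒> λ Δ≤1 → not-star (isStar-of-degree≤1 H sided b λ v sv → ≤-trans (proj₂ (maxDegree b) v sv) Δ≤1)

    2≤classSize : ∀ b → 2 ≤ classSize b
    2≤classSize b = let (v , sv , dv) , _ = maxDegree (not b) in begin
      2                               ≤⟨ 2≤Δ (not b) ⟩
      Δ (not b)                       ≡⟨ dv ⟨
      degree v                        ≤⟨ Sided.degree≤classSize sided v ⟩
      classSize (not (side v))        ≡⟨ cong classSize (trans (cong not sv) (not-involutive b)) ⟩
      classSize b                     ∎
      where open ≤-Reasoning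

    arrows-bound : ∀ {N} (G : Graph N) b → Arrows r G H → r * r * (classSize b * Δ b) ≤ 1152 * size G
    arrows-bound G b arr = ≮⇒≥ λ few → split (Δ b) (2≤Δ b) (proj₂ (proj₂ (proj₁ (maxDegree b)))) few
      where
      c = classSize b
      t₀ = proj₁ (proj₁ (maxDegree b))
      1≤half : 1 ≤ c div 2
      1≤half = /-monoˡ-≤ 2 (2≤classSize b)
      c≤3half : c ≤ 3 * (c div 2)
      c≤3half = begin
        c                       ≡⟨ m≡m%n+[m/n]*n c 2 ⟩
        c mod 2 + c div 2 * 2       ≤⟨ +-mono-≤ (≤-trans (≤-pred (m%n<n c 2)) 1≤half) (≤-reflexive (*-comm (c div 2) 2)) ⟩
        3 * (c div 2)             ∎
        where open ≤-Reasoning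
      split : ∀ k → 2 ≤ k → degree t₀ ≡ k → ¬ 1152 * size G < r * r * (c * k)
      split (suc zero) (s≤s ())
      split (suc (suc d)) 2≤k deg few =
        AvoidingColouring.not-arrows H sided b G r (suc d) (c div 2) 6≤r t₀ (proj₁ (proj₂ (proj₁ (maxDegree b)))) deg
          c≤3half (≤-trans (≤-reflexive (*-comm 2 (c div 2))) (m/n*n≤m c 2)) few arr
        where
        instance
          r-nonZero : NonZero r
          r-nonZero = >-nonZero (≤-trans (s≤s z≤n) 6≤r)
          half-nonZero : NonZero (c div 2)
          half-nonZero = >-nonZero 1≤half

    r²β≤2304size : ∀ {N} (G : Graph N) → Arrows r G H → r ^ 2 * β n₁ n₂ Δ₁ Δ₂ ≤ 2304 * size G
    r²β≤2304size G arr = begin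
      r ^ 2 * (n₁ * Δ₁ + n₂ * Δ₂)                    ≡⟨ cong₂ (λ a b → r ^ 2 * (a * Δ₁ + b * Δ₂)) classSize-true classSize-false ⟨
      r ^ 2 * (classSize true * Δ₁ + classSize false * Δ₂) ≡⟨ regroup r (classSize true * Δ₁) (classSize false * Δ₂) ⟩
      r * r * (classSize true * Δ₁) + r * r * (classSize false * Δ₂)
                                                     ≤⟨ +-mono-≤ (arrows-bound G true arr) (arrows-bound G false arr) ⟩
      1152 * size G + 1152 * size G                  ≡⟨ *-distribʳ-+ (size G) 1152 1152 ⟨
      2304 * size G                                  ∎
      where
      open ≤-Reasoning
      regroup : ∀ r a b → r * (r * 1) * (a + b) ≡ r * r * a + r * r * b
      regroup = solve-∀

    sizeRamsey-bounds : Graph.Acyclic H →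
      ∃[ R ] (IsSizeRamsey r H R × r ^ 2 * β n₁ n₂ Δ₁ Δ₂ ≤ 2304 * R × R ≤ 4 * r ^ 2 * (n₁ * n₂))
    sizeRamsey-bounds acyclic = bounds
      (sizeRamsey-exists r H (Sided.neighbour sided) K₀ (completeBipartite-arrows H sided acyclic r 6≤r))
      where
      K₀ = CompleteBipartite.K (2 * r * classSize true) (2 * r * classSize false)
      K₀-size : size K₀ ≡ 4 * r ^ 2 * (n₁ * n₂)
      K₀-size = trans (size-K (2 * r * classSize true) (2 * r * classSize false))
        (trans (cong₂ (λ a b → 2 * r * a * (2 * r * b)) classSize-true classSize-false) (regroup r n₁ n₂))
        where
        regroup : ∀ r a b → 2 * r * a * (2 * r * b) ≡ 4 * (r * (r * 1)) * (a * b)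
        regroup = solve-∀
      bounds : ∃[ R ] (IsSizeRamsey r H R × R ≤ size K₀) →
        ∃[ R ] (IsSizeRamsey r H R × r ^ 2 * β n₁ n₂ Δ₁ Δ₂ ≤ 2304 * R × R ≤ 4 * r ^ 2 * (n₁ * n₂))
      bounds (R , ramsey@((_ , G , arr , G≡R) , _) , R≤) =
        R , ramsey , subst (λ z → r ^ 2 * β n₁ n₂ Δ₁ Δ₂ ≤ 2304 * z) G≡R (r²β≤2304size G arr) , ≤-trans R≤ (≤-reflexive K₀-size)

open import Data.Integer using (+_)
import Data.Integer as ℤ
import Data.Integer.Properties as ℤ
open import Data.Rational using (ℚ; 0ℚ; 1ℚ; _/_; Positive; NonNegative; toℚᵘ; fromℚᵘ; 1/_; positive) renaming (_<_ to _<ℚ_; _≤_ to _≤ℚ_; _*_ to _*ℚ_)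
import Data.Rational.Properties as ℚ
open import Data.Rational.Unnormalised using (mkℚᵘ; *≡*; *≤*) renaming (_*_ to _*ᵘ_; _≤_ to _≤ᵘ_)
import Data.Rational.Unnormalised.Properties as ℚᵘ

-- Rational arithmetic

fromℚᵘ-* : ∀ p q → fromℚᵘ (p *ᵘ q) ≡ fromℚᵘ p *ℚ fromℚᵘ q
fromℚᵘ-* p q = ℚ.toℚᵘ-injective (ℚᵘ.≃-trans (ℚ.toℚᵘ-fromℚᵘ (p *ᵘ q)) (ℚᵘ.≃-sym
  (ℚᵘ.≃-trans (ℚ.toℚᵘ-homo-* (fromℚᵘ p) (fromℚᵘ q)) (ℚᵘ.*-cong (ℚ.toℚᵘ-fromℚᵘ p) (ℚ.toℚᵘ-fromℚᵘ q)))))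

fromℚᵘ-mono-≤ : ∀ {p q} → p ≤ᵘ q → fromℚᵘ p ≤ℚ fromℚᵘ q
fromℚᵘ-mono-≤ {p} {q} p≤q = ℚ.toℚᵘ-cancel-≤ (begin
  toℚᵘ (fromℚᵘ p) ≃⟨ ℚ.toℚᵘ-fromℚᵘ p ⟩
  p               ≤⟨ p≤q ⟩
  q               ≃⟨ ℚ.toℚᵘ-fromℚᵘ q ⟨
  toℚᵘ (fromℚᵘ q) ∎)
  where open ℚᵘ.≤-Reasoning

fromNat-* : ∀ a b → fromNat (a * b) ≡ fromNat a *ℚ fromNat b
fromNat-* a b = trans (ℚ.fromℚᵘ-cong {mkℚᵘ (+ (a * b)) 0} {mkℚᵘ (+ a) 0 *ᵘ mkℚᵘ (+ b) 0}
                         (*≡* (cong (ℤ._* + 1) (ℤ.pos-* a b))))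
                      (fromℚᵘ-* (mkℚᵘ (+ a) 0) (mkℚᵘ (+ b) 0))

fromNat-mono : ∀ {a b} → a ≤ b → fromNat a ≤ℚ fromNat b
fromNat-mono {a} {b} a≤b = fromℚᵘ-mono-≤ {mkℚᵘ (+ a) 0} {mkℚᵘ (+ b) 0} (*≤* (ℤ.*-monoʳ-≤-nonNeg (+ 1) (ℤ.+≤+ a≤b)))

fromNat-nonNeg : ∀ a → NonNegative (fromNat a)
fromNat-nonNeg a = ℚ.normalize-nonNeg a 1

1/2304 : ℚ
1/2304 = + 1 / 2304

n/2304 : ∀ a → + a / 2304 ≡ 1/2304 *ℚ fromNat a
n/2304 a = trans (ℚ.fromℚᵘ-cong {mkℚᵘ (+ a) 2303} {mkℚᵘ (+ 1) 2303 *ᵘ mkℚᵘ (+ a) 0}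
                    (*≡* (cong (ℤ._* + 2304) (sym (ℤ.*-identityˡ (+ a))))))
                 (fromℚᵘ-* (mkℚᵘ (+ 1) 2303) (mkℚᵘ (+ a) 0))

≤-1/2304 : ∀ a R → a ≤ 2304 * R → 1/2304 *ℚ fromNat a ≤ℚ fromNat R
≤-1/2304 a R a≤ = begin
  1/2304 *ℚ fromNat a                      ≤⟨ ℚ.*-monoˡ-≤-nonNeg 1/2304 (fromNat-mono {a} {2304 * R} a≤) ⟩
  1/2304 *ℚ fromNat (2304 * R)             ≡⟨ cong (1/2304 *ℚ_) (fromNat-* 2304 R) ⟩
  1/2304 *ℚ (fromNat 2304 *ℚ fromNat R)    ≡⟨ ℚ.*-assoc 1/2304 (fromNat 2304) (fromNat R) ⟨
  1ℚ *ℚ fromNat R                          ≡⟨ ℚ.*-identityˡ (fromNat R) ⟩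
  fromNat R                                ∎
  where open ℚ.≤-Reasoning

full-lower-bound : ∀ (p : ℚ) k b N R → p *ℚ fromNat N ≤ℚ fromNat b → k * b ≤ 2304 * R →
                   p *ℚ (+ (k * N) / 2304) ≤ℚ fromNat R
full-lower-bound p k b N R pN≤b kb≤R = begin
  p *ℚ (+ (k * N) / 2304)                        ≡⟨ cong (p *ℚ_) (trans (n/2304 (k * N)) (cong (1/2304 *ℚ_) (fromNat-* k N))) ⟩
  p *ℚ (1/2304 *ℚ (fromNat k *ℚ fromNat N))      ≡⟨ cong (p *ℚ_) (ℚ.*-assoc 1/2304 (fromNat k) (fromNat N)) ⟨
  p *ℚ (w *ℚ fromNat N)                          ≡⟨ ℚ.*-assoc p w (fromNat N) ⟨
  p *ℚ w *ℚ fromNat N                            ≡⟨ cong (_*ℚ fromNat N) (ℚ.*-comm p w) ⟩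
  w *ℚ p *ℚ fromNat N                            ≡⟨ ℚ.*-assoc w p (fromNat N) ⟩
  w *ℚ (p *ℚ fromNat N)                          ≤⟨ ℚ.*-monoˡ-≤-nonNeg w pN≤b ⟩
  w *ℚ fromNat b                                 ≡⟨ ℚ.*-assoc 1/2304 (fromNat k) (fromNat b) ⟩
  1/2304 *ℚ (fromNat k *ℚ fromNat b)             ≡⟨ cong (1/2304 *ℚ_) (fromNat-* k b) ⟨
  1/2304 *ℚ fromNat (k * b)                      ≤⟨ ≤-1/2304 (k * b) R kb≤R ⟩
  fromNat R                                      ∎
  where
  open ℚ.≤-Reasoning
  w = 1/2304 *ℚ fromNat k
  instance
    w-nonNeg : NonNegative w
    w-nonNeg = ℚ.nonNeg*nonNeg⇒nonNeg 1/2304 (fromNat k) {{fromNat-nonNeg k}}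

module _ (p : ℚ) {{p-pos : Positive p}} where

  private
    instance
      p-nonZero = ℚ.pos⇒nonZero p
      1/p-pos : Positive (1/ p)
      1/p-pos = ℚ.1/pos⇒pos p

  4/p : ℚ
  4/p = fromNat 4 *ℚ 1/ p

  4/p-pos : Positive 4/p
  4/p-pos = ℚ.pos*pos⇒pos (fromNat 4) (1/ p)

  full-upper-bound : ∀ k b N R → p *ℚ fromNat N ≤ℚ fromNat b → R ≤ 4 * k * N →
                     fromNat R ≤ℚ 4/p *ℚ fromNat (k * b)
  full-upper-bound k b N R pN≤b R≤ = begin
    fromNat R                                  ≤⟨ fromNat-mono {R} {4 * k * N} R≤ ⟩
    fromNat (4 * k * N)                        ≡⟨ trans (fromNat-* (4 * k) N) (cong (_*ℚ fromNat N) (fromNat-* 4 k)) ⟩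
    fromNat 4 *ℚ fromNat k *ℚ fromNat N        ≡⟨ cong (λ z → fromNat 4 *ℚ z *ℚ fromNat N) cancel ⟩
    fromNat 4 *ℚ (1/ p *ℚ (fromNat k *ℚ p)) *ℚ fromNat N
      ≡⟨ cong (_*ℚ fromNat N) (trans (ℚ.*-assoc 4/p (fromNat k) p) (ℚ.*-assoc (fromNat 4) (1/ p) (fromNat k *ℚ p))) ⟨
    w *ℚ p *ℚ fromNat N                        ≡⟨ ℚ.*-assoc w p (fromNat N) ⟩
    w *ℚ (p *ℚ fromNat N)                      ≤⟨ ℚ.*-monoˡ-≤-nonNeg w pN≤b ⟩
    w *ℚ fromNat b                             ≡⟨ ℚ.*-assoc 4/p (fromNat k) (fromNat b) ⟩
    4/p *ℚ (fromNat k *ℚ fromNat b)            ≡⟨ cong (4/p *ℚ_) (fromNat-* k b) ⟨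
    4/p *ℚ fromNat (k * b)                     ∎
    where
    open ℚ.≤-Reasoning
    w = 4/p *ℚ fromNat k
    instance
      w-nonNeg : NonNegative w
      w-nonNeg = ℚ.nonNeg*nonNeg⇒nonNeg 4/p {{ℚ.pos⇒nonNeg 4/p {{4/p-pos}}}} (fromNat k) {{fromNat-nonNeg k}}
    cancel : fromNat k ≡ 1/ p *ℚ (fromNat k *ℚ p)
    cancel = sym (trans (cong (1/ p *ℚ_) (ℚ.*-comm (fromNat k) p))
               (trans (sym (ℚ.*-assoc (1/ p) p (fromNat k)))
                 (trans (cong (_*ℚ fromNat k) (ℚ.*-inverseˡ p)) (ℚ.*-identityˡ (fromNat k)))))

explicit-bounds : ∀ α r {n} (T : Graph n) n₁ n₂ Δ₁ Δ₂ → Full α n₁ n₂ Δ₁ Δ₂ →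
  ∃[ R ] (IsSizeRamsey r T R × r ^ 2 * β n₁ n₂ Δ₁ Δ₂ ≤ 2304 * R × R ≤ 4 * r ^ 2 * (n₁ * n₂)) →
  ∃[ R ] (IsSizeRamsey r T R
    × (α · (+ (r ^ 2 * (n₁ * n₂)) / 2304) ≤ʳ fromNat R)
    × (R ≤ 4 * r ^ 2 * (n₁ * n₂) + 4 * r * (n₁ + n₂) + 1))
explicit-bounds α r T n₁ n₂ Δ₁ Δ₂ full (R , ramsey , lower , upper) =
  R , ramsey ,
  (λ p p<α → full-lower-bound p (r ^ 2) (β n₁ n₂ Δ₁ Δ₂) (n₁ * n₂) R (full p p<α) lower) ,
  ≤-trans upper (≤-trans (m≤m+n _ _) (m≤m+n _ 1))

asymptotic-bounds : ∀ (p : ℚ) {{_ : Positive p}} r {n} (T : Graph n) n₁ n₂ Δ₁ Δ₂ →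
  p *ℚ fromNat (n₁ * n₂) ≤ℚ fromNat (β n₁ n₂ Δ₁ Δ₂) →
  ∃[ R ] (IsSizeRamsey r T R × r ^ 2 * β n₁ n₂ Δ₁ Δ₂ ≤ 2304 * R × R ≤ 4 * r ^ 2 * (n₁ * n₂)) →
  ∃[ R ] (IsSizeRamsey r T R
    × ((1/2304 *ℚ fromNat (r ^ 2 * β n₁ n₂ Δ₁ Δ₂)) ≤ℚ fromNat R)
    × (fromNat R ≤ℚ (4/p p *ℚ fromNat (r ^ 2 * β n₁ n₂ Δ₁ Δ₂))))
asymptotic-bounds p r T n₁ n₂ Δ₁ Δ₂ full (R , ramsey , lower , upper) =
  R , ramsey , ≤-1/2304 (r ^ 2 * β n₁ n₂ Δ₁ Δ₂) R lower ,
  full-upper-bound p (r ^ 2) (β n₁ n₂ Δ₁ Δ₂) (n₁ * n₂) R full upper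

theorem1p4 : (∀ (r : ℕ) → 6 ≤ r →
    ∃[ n₀ ] (∀ (α : ℝ) → 0ℚ <ʳ α → α ≤ʳ fromNat 2 →
    ∀ {n} (T : Graph n) (n₁ n₂ Δ₁ Δ₂ : ℕ) →
    IsBipartiteTree T n₁ n₂ Δ₁ Δ₂ → Full α n₁ n₂ Δ₁ Δ₂ →
    n₀ ≤ n₁ + n₂ → ¬ IsStar T →
    ∃[ R ] (IsSizeRamsey r T R
    × (α · (+ (r ^ 2 * (n₁ * n₂)) / 2304) ≤ʳ fromNat R)
    × (R ≤ 4 * r ^ 2 * (n₁ * n₂) + 4 * r * (n₁ + n₂) + 1))))
    × (∀ (α : ℝ) → 0ℚ <ʳ α → α ≤ʳ fromNat 2 →
    ∃[ c ] ∃[ C ] (0ℚ <ℚ c × 0ℚ <ℚ C ×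
    (∀ (r : ℕ) → 6 ≤ r →
    ∃[ n₀ ] (∀ {n} (T : Graph n) (n₁ n₂ Δ₁ Δ₂ : ℕ) →
    IsBipartiteTree T n₁ n₂ Δ₁ Δ₂ → Full α n₁ n₂ Δ₁ Δ₂ →
    n₀ ≤ n₁ + n₂ → ¬ IsStar T →
    ∃[ R ] (IsSizeRamsey r T R
    × ((c *ℚ fromNat (r ^ 2 * β n₁ n₂ Δ₁ Δ₂)) ≤ℚ fromNat R)
    × (fromNat R ≤ℚ (C *ℚ fromNat (r ^ 2 * β n₁ n₂ Δ₁ Δ₂))))))))
theorem1p4 =
  (λ r 6≤r → 0 , λ α _ _ T n₁ n₂ Δ₁ Δ₂ (bip , acyclic) full _ not-star →
    explicit-bounds α r T n₁ n₂ Δ₁ Δ₂ full (sizeRamsey-bounds T bip not-star r 6≤r acyclic)) ,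
  λ α 0<α _ →
    let p , 0<p , p<α = Equivalence.to (ℝ.L-rounded α 0ℚ) 0<α
        p-pos = positive 0<p in
    1/2304 , 4/p p {{p-pos}} , ℚ.positive⁻¹ 1/2304 , ℚ.positive⁻¹ (4/p p {{p-pos}}) {{4/p-pos p {{p-pos}}}} ,
    λ r 6≤r → 0 , λ T n₁ n₂ Δ₁ Δ₂ (bip , acyclic) full _ not-star →
      asymptotic-bounds p {{p-pos}} r T n₁ n₂ Δ₁ Δ₂ (full p p<α) (sizeRamsey-bounds T bip not-star r 6≤r acyclic)
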